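{- Let $i\in\{0,1\}$. The normal $\mathcal{L}$-logic $\mathbf{L}_i$ is sound and complete with respect to its corresponding class $\mathcal{K}_i$ of graph-based $\mathbf{A}$-frames, where $\mathcal{K}_0$ is the class of graph-based $\mathbf{A}$-frames on which $\Box\bot\vdash\bot$ is valid and $\mathcal{K}_1$ is the class of graph-based $\mathbf{A}$-frames on which $\Box p\vdash p$ is valid. That is, for all formulas $\phi,\psi\in\mathcal{L}$, the sequent $\phi\vdash\psi$ belongs to $\mathbf{L}_i$ if and only if $\phi\vdash\psi$ is valid on every $\mathbb{G}\in\mathcal{K}_i$.
   Context: **Truth values.** $\mathbf{A}=(D,1,0,\vee,\wedge,\otimes,\to)$ is a fixed complete lattice with top $1$ and bottom $0$, $0\neq 1$, that is frame-distributive ($a\wedge\bigvee_i b_i=\bigvee_i(a\wedge b_i)$) and dually frame-distributive ($a\vee\bigwedge_i b_i=\bigwedge_i(a\vee b_i)$), with a commutative associative operation $\otimes$ residuated by $\to$ ($\alpha\otimes\beta\le\gamma$ iff $\alpha\le\beta\to\gamma$), and such that $1\to\alpha=\alpha$ for all $\alpha$. For a set $W$, $\mathbf{A}^W$ is the set of maps $W\to\mathbf{A}$, ordered pointwise; $u\subseteq v$ means $u\le v$ pointwise. For $\alpha\in\mathbf{A}$, $w\in W$, the map $\{\alpha/w\}:W\to\mathbf{A}$ sends $w$ to $\alpha$ and every other element to $0$. An $\mathbf{A}$-relation $E:Z\times Z\to\mathbf{A}$ is reflexive if $E(z,z)=1$ for all $z$. **Language and logics.** Let $\mathsf{Prop}$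 be a countable or finite set of atomic propositions. Formulas of $\mathcal{L}$: $\varphi::=\bot\mid\top\mid p\mid\varphi\wedge\varphi\mid\varphi\vee\varphi\mid\Box\varphi\mid\Diamond\varphi$, with $p\in\mathsf{Prop}$. A sequent is an expression $\phi\vdash\psi$ with $\phi,\psi\in\mathcal{L}$. The basic logic $\mathbf{L}$ is the least set of sequents containing the axioms $p\vdash p$, $\bot\vdash p$, $p\vdash\top$, $p\vdash p\vee q$, $q\vdash p\vee q$, $p\wedge q\vdash p$, $p\wedge q\vdash q$, $\top\vdash\Box\top$, $\Box p\wedge\Box q\vdash\Box(p\wedge q)$, $\Diamond\bot\vdash\bot$, $\Diamond(p\vee q)\vdash\Diamond p\vee\Diamond q$, and closed under: from $\phi\vdash\chi$ and $\chi\vdash\psi$ infer $\phi\vdash\psi$; uniform substitution of formulas for atomic propositions; from $\chi\vdash\phi$ and $\chi\vdash\psi$ infer $\chi\vdash\phi\wedge\psi$; from $\phi\vdash\chi$ and $\psi\vdash\chi$ infer $\phi\vee\psi\vdash\chi$; from $\phi\vdash\psi$ infer $\Box\phi\vdash\Box\psi$; from $\phi\vdash\psi$ infer $\Diamond\phi\vdash\Diamond\psi$. $\mathbf{L}_0$ (resp. $\mathbf{L}_1$) is the least such set additionally containing $\Box\bot\vdash\bot$ (resp. $\Box p\vdash p$). **Frames (convention used for this result).** Let $Z$ be a nonempty set, $E:Z\times Z\to\mathbf{A}$ reflexive, and $R_\Diamond,R_\Box:Z\times Z\to\mathbf{A}$. Put $Z_A:=Z$ and $Z_X:=\mathbf{A}\times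 Z$. For $f:Z_A\to\mathbf{A}$ and $u:Z_X\to\mathbf{A}$ define - $f^{[1]}(\alpha,z)=\bigwedge_{z'\in Z}[f(z')\to(E(z',z)\to\alpha)]$, - $u^{[0]}(z)=\bigwedge_{(\alpha,z')\in Z_X}[u(\alpha,z')\to(E(z,z')\to\alpha)]$, - $R_\Box^{[0]}[u](z)=\bigwedge_{(\alpha,z')\in Z_X}[u(\alpha,z')\to(R_\Box(z,z')\to\alpha)]$, - $R_\Box^{[1]}[f](\alpha,z)=\bigwedge_{z'\in Z}[f(z')\to(R_\Box(z',z)\to\alpha)]$, - $R_\Diamond^{[0]}[f](\alpha,z)=\bigwedge_{z'\in Z}[f(z')\to(R_\Diamond(z,z')\to\alpha)]$, - $R_\Diamond^{[1]}[u](z)=\bigwedge_{(\alpha,z')\in Z_X}[u(\alpha,z')\to(R_\Diamond(z',z)\to\alpha)]$, and write $f^{[10]}=(f^{[1]})^{[0]}$, $u^{[01]}=(u^{[0]})^{[1]}$. The structure $\mathbb{G}=(Z,E,R_\Diamond,R_\Box)$ is a *graph-based $\mathbf{A}$-frame* if for all $z\in Z$, $\alpha,\beta\in\mathbf{A}$: $(R_\Box^{[0]}[\{\beta/(\alpha,z)\}])^{[10]}\subseteq R_\Box^{[0]}[\{\beta/(\alpha,z)\}]$, $(R_\Box^{[1]}[\{\beta/z\}])^{[01]}\subseteq R_\Box^{[1]}[\{\beta/z\}]$, $(R_\Diamond^{[1]}[\{\beta/(\alpha,z)\}])^{[10]}\subseteq R_\Diamond^{[1]}[\{\beta/(\alpha,z)\}]$,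 $(R_\Diamond^{[0]}[\{\beta/z\}])^{[01]}\subseteq R_\Diamond^{[0]}[\{\beta/z\}]$. **Models and validity.** A model on $\mathbb{G}$ is given by a valuation $V$ assigning to each $p\in\mathsf{Prop}$ a pair $V(p)=([\![p]\!],(\![p]\!))$ with $[\![p]\!]:Z_A\to\mathbf{A}$, $(\![p]\!):Z_X\to\mathbf{A}$, $[\![p]\!]^{[1]}=(\![p]\!)$ and $(\![p]\!)^{[0]}=[\![p]\!]$, extended to all formulas by - $[\![\top]\!]=1$ (constant), $(\![\top]\!)=[\![\top]\!]^{[1]}$; $(\![\bot]\!)=1$ (constant), $[\![\bot]\!]=(\![\bot]\!)^{[0]}$; - $[\![\phi\wedge\psi]\!]=[\![\phi]\!]\wedge[\![\psi]\!]$, $(\![\phi\wedge\psi]\!)=[\![\phi\wedge\psi]\!]^{[1]}$; $(\![\phi\vee\psi]\!)=(\![\phi]\!)\wedge(\![\psi]\!)$, $[\![\phi\vee\psi]\!]=(\![\phi\vee\psi]\!)^{[0]}$; - $[\![\Box\phi]\!]=R_\Box^{[0]}[(\![\phi]\!)]$, $(\![\Box\phi]\!)=[\![\Box\phi]\!]^{[1]}$; $(\![\Diamond\phi]\!)=R_\Diamond^{[0]}[[\![\phi]\!]]$, $[\![\Diamond\phi]\!]=(\![\Diamond\phi]\!)^{[0]}$. A sequent $\phi\vdash\psi$ is true in a model if $[\![\phi]\!]\subseteq[\![\psi]\!]$, and valid on $\mathbb{G}$ if it is true in every model on $\mathbb{G}$. -}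

module Defs where

open import Algebra.Core using (Op₂)
open import Algebra.Definitions using (Associative; Commutative)
open import Data.Product using (_×_; _,_)
open import Function.Bundles using (_⇔_)
open import Level using (Level; 0ℓ) renaming (suc to lsuc)
open import Relation.Binary.Core using (Rel)
open import Relation.Binary.Lattice.Structures using (IsBoundedLattice)
open import Relation.Binary.PropositionalEquality using (_≡_; _≢_; _≗_)
open import Relation.Unary using (Pred; _∈_; ｛_｝)

-- "Set" is read as a type in one fixed universe ℓ: the lattice itself, the
-- index types of its joins and meets, and the carriers of frames.
record TruthValues (ℓ : Level) : Set (lsuc ℓ) where
  infix  4 _≤_
  infixr 5 _⇒_
  infixr 6 _∨_
  infixr 7 _∧_
  infixr 8 _⊗_
  field
    Carrier          : Set ℓ
    _≤_              : Rel Carrier ℓ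
    _∨_ _∧_ _⊗_ _⇒_  : Op₂ Carrier
    𝟏 𝟎              : Carrier
    isBoundedLattice : IsBoundedLattice _≡_ _≤_ _∨_ _∧_ 𝟏 𝟎
    𝟎≢𝟏              : 𝟎 ≢ 𝟏

    ⋁ ⋀              : {I : Set ℓ} → (I → Carrier) → Carrier
    ⋁-upper          : {I : Set ℓ} (f : I → Carrier) → ∀ i → f i ≤ ⋁ f
    ⋁-least          : {I : Set ℓ} (f : I → Carrier) → ∀ a → (∀ i → f i ≤ a) → ⋁ f ≤ a
    ⋀-lower          : {I : Set ℓ} (f : I → Carrier) → ∀ i → ⋀ f ≤ f i
    ⋀-greatest       : {I : Set ℓ} (f : I → Carrier) → ∀ a → (∀ i → a ≤ f i) → a ≤ ⋀ f
    ∧-distrib-⋁      : {I : Set ℓ} (a : Carrier) (f : I → Carrier) →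
                       a ∧ ⋁ f ≡ ⋁ (λ i → a ∧ f i)
    ∨-distrib-⋀      : {I : Set ℓ} (a : Carrier) (f : I → Carrier) →
                       a ∨ ⋀ f ≡ ⋀ (λ i → a ∨ f i)

    ⊗-assoc          : Associative _≡_ _⊗_
    ⊗-comm           : Commutative _≡_ _⊗_
    residuation      : ∀ α β γ → (α ⊗ β ≤ γ) ⇔ (α ≤ β ⇒ γ)
    𝟏-⇒              : ∀ α → 𝟏 ⇒ α ≡ α

module _ (Atom : Set) where

  infix  4 _⊢_
  infixr 6 _∨_
  infixr 7 _∧_
  infix  8 □_ ◇_

  data Fm : Set where
    ⊥ ⊤     : Fm
    var     : Atom → Fm
    _∧_ _∨_ : Fm → Fm → Fm
    □_ ◇_   : Fm → Fm

  data Sequent : Set where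
    _⊢_ : Fm → Fm → Sequent

module _ {Atom : Set} where

  infix 9 _[_] _[_]ₛ

  _[_] : Fm Atom → (Atom → Fm Atom) → Fm Atom
  ⊥       [ σ ] = ⊥
  ⊤       [ σ ] = ⊤
  var p   [ σ ] = σ p
  (φ ∧ ψ) [ σ ] = φ [ σ ] ∧ ψ [ σ ]
  (φ ∨ ψ) [ σ ] = φ [ σ ] ∨ ψ [ σ ]
  (□ φ)   [ σ ] = □ (φ [ σ ])
  (◇ φ)   [ σ ] = ◇ (φ [ σ ])

  _[_]ₛ : Sequent Atom → (Atom → Fm Atom) → Sequent Atom
  (φ ⊢ ψ) [ σ ]ₛ = φ [ σ ] ⊢ ψ [ σ ]

  -- The least normal logic containing Ax; the basic logic is Logic ∅.  The
  -- letters p and q in the axioms of the basic logic are schematic.  Since the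
  -- logic is closed under substitution this agrees with taking them to be two
  -- distinct atoms, but it does not depend on two atoms being available.
  data Logic (Ax : Pred (Sequent Atom) 0ℓ) : Pred (Sequent Atom) 0ℓ where
    axiom  : ∀ {s} → s ∈ Ax → Logic Ax s

    id     : ∀ {p}   → Logic Ax (p ⊢ p)
    ⊥-out  : ∀ {p}   → Logic Ax (⊥ ⊢ p)
    ⊤-in   : ∀ {p}   → Logic Ax (p ⊢ ⊤)
    ∨-inˡ  : ∀ {p q} → Logic Ax (p ⊢ p ∨ q)
    ∨-inʳ  : ∀ {p q} → Logic Ax (q ⊢ p ∨ q)
    ∧-outˡ : ∀ {p q} → Logic Ax (p ∧ q ⊢ p)
    ∧-outʳ : ∀ {p q} → Logic Ax (p ∧ q ⊢ q)
    □-⊤    : Logic Ax (⊤ ⊢ □ ⊤)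
    □-∧    : ∀ {p q} → Logic Ax (□ p ∧ □ q ⊢ □ (p ∧ q))
    ◇-⊥    : Logic Ax (◇ ⊥ ⊢ ⊥)
    ◇-∨    : ∀ {p q} → Logic Ax (◇ (p ∨ q) ⊢ ◇ p ∨ ◇ q)

    cut    : ∀ {φ χ ψ} → Logic Ax (φ ⊢ χ) → Logic Ax (χ ⊢ ψ) → Logic Ax (φ ⊢ ψ)
    subst  : ∀ {s} (σ : Atom → Fm Atom) → Logic Ax s → Logic Ax (s [ σ ]ₛ)
    ∧-in   : ∀ {χ φ ψ} → Logic Ax (χ ⊢ φ) → Logic Ax (χ ⊢ ψ) → Logic Ax (χ ⊢ φ ∧ ψ)
    ∨-out  : ∀ {φ ψ χ} → Logic Ax (φ ⊢ χ) → Logic Ax (ψ ⊢ χ) → Logic Ax (φ ∨ ψ ⊢ χ)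
    □-mono : ∀ {φ ψ} → Logic Ax (φ ⊢ ψ) → Logic Ax (□ φ ⊢ □ ψ)
    ◇-mono : ∀ {φ ψ} → Logic Ax (φ ⊢ ψ) → Logic Ax (◇ φ ⊢ ◇ ψ)

  axiom₀ : Sequent Atom
  axiom₀ = □ ⊥ ⊢ ⊥

  axiom₁ : Atom → Sequent Atom
  axiom₁ p = □ var p ⊢ var p

  L₀ : Pred (Sequent Atom) 0ℓ
  L₀ = Logic ｛ axiom₀ ｝

  -- By closure under substitution L₁ p does not depend on the atom p.
  L₁ : Atom → Pred (Sequent Atom) 0ℓ
  L₁ p = Logic ｛ axiom₁ p ｝

module Pointwise {ℓ : Level} (𝐀 : TruthValues ℓ) where

  open TruthValues 𝐀 using (_≤_; ⋁) renaming (Carrier to A)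

  infix 4 _⊆_

  _⊆_ : {W : Set ℓ} → Rel (W → A) ℓ
  u ⊆ v = ∀ w → u w ≤ v w

  -- The join over proofs of w ≡ w′ is β if there is one, and otherwise the
  -- empty join 𝟎; equality on W need not be decidable.
  ⁅_/_⁆ : {W : Set ℓ} → A → W → W → A
  ⁅ β / w ⁆ w′ = ⋁ {w ≡ w′} (λ _ → β)

module _ {ℓ : Level} (𝐀 : TruthValues ℓ) where

  open TruthValues 𝐀 using (𝟏; ⋀; _⇒_) renaming (Carrier to A)
  open Pointwise 𝐀

  record Graph : Set (lsuc ℓ) where
    field
      Z        : Set ℓ
      nonempty : Z
      E R◇ R□  : Z → Z → A
      E-refl   : ∀ z → E z z ≡ 𝟏

    Z-A Z-X : Set ℓ
    Z-A = Z
    Z-X = A × Z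

    infix 10 _^[1] _^[0] _^[10] _^[01]

    _^[1] : (Z-A → A) → (Z-X → A)
    (f ^[1]) (α , z) = ⋀ λ z′ → f z′ ⇒ (E z′ z ⇒ α)

    _^[0] : (Z-X → A) → (Z-A → A)
    (u ^[0]) z = ⋀ λ ((α , z′) : Z-X) → u (α , z′) ⇒ (E z z′ ⇒ α)

    R□^[0] : (Z-X → A) → (Z-A → A)
    R□^[0] u z = ⋀ λ ((α , z′) : Z-X) → u (α , z′) ⇒ (R□ z z′ ⇒ α)

    R□^[1] : (Z-A → A) → (Z-X → A)
    R□^[1] f (α , z) = ⋀ λ z′ → f z′ ⇒ (R□ z′ z ⇒ α)

    R◇^[0] : (Z-A → A) → (Z-X → A)
    R◇^[0] f (α , z) = ⋀ λ z′ → f z′ ⇒ (R◇ z z′ ⇒ α)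

    R◇^[1] : (Z-X → A) → (Z-A → A)
    R◇^[1] u z = ⋀ λ ((α , z′) : Z-X) → u (α , z′) ⇒ (R◇ z′ z ⇒ α)

    _^[10] : (Z-A → A) → (Z-A → A)
    f ^[10] = (f ^[1]) ^[0]

    _^[01] : (Z-X → A) → (Z-X → A)
    u ^[01] = (u ^[0]) ^[1]

  record Frame : Set (lsuc ℓ) where
    field
      graph : Graph
    open Graph graph public
    field
      R□^[0]-stable : ∀ z α β → R□^[0] ⁅ β / (α , z) ⁆ ^[10] ⊆ R□^[0] ⁅ β / (α , z) ⁆
      R□^[1]-stable : ∀ z β   → R□^[1] ⁅ β / z ⁆ ^[01] ⊆ R□^[1] ⁅ β / z ⁆
      R◇^[1]-stable : ∀ z α β → R◇^[1] ⁅ β / (α , z) ⁆ ^[10] ⊆ R◇^[1] ⁅ β / (α , z) ⁆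
      R◇^[0]-stable : ∀ z β   → R◇^[0] ⁅ β / z ⁆ ^[01] ⊆ R◇^[0] ⁅ β / z ⁆

module _ {ℓ : Level} {𝐀 : TruthValues ℓ} where

  open TruthValues 𝐀 using (𝟏) renaming (Carrier to A; _∧_ to _⊓_)
  open Pointwise 𝐀 using (_⊆_)

  record Valuation (Atom : Set) (𝔾 : Frame 𝐀) : Set ℓ where
    open Frame 𝔾
    field
      ext     : Atom → Z-A → A
      int     : Atom → Z-X → A
      ext^[1] : ∀ p → ext p ^[1] ≗ int p
      int^[0] : ∀ p → int p ^[0] ≗ ext p

  module _ {Atom : Set} {𝔾 : Frame 𝐀} (V : Valuation Atom 𝔾) where
    open Frame 𝔾
    open Valuation V

    -- For φ = ⊥, χ ∨ ψ, ◇ ψ the clause for ⟦ φ ⟧ is ⦅ φ ⦆ ^[0] with ⦅ φ ⦆ unfolded,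
    -- as the termination checker requires.
    ⟦_⟧ : Fm Atom → Z-A → A
    ⦅_⦆ : Fm Atom → Z-X → A

    ⟦ ⊥ ⟧         = (λ _ → 𝟏) ^[0]
    ⟦ ⊤ ⟧         = λ _ → 𝟏
    ⟦ var p ⟧     = ext p
    ⟦ φ ∧ ψ ⟧     = λ z → ⟦ φ ⟧ z ⊓ ⟦ ψ ⟧ z
    ⟦ φ ∨ ψ ⟧     = (λ x → ⦅ φ ⦆ x ⊓ ⦅ ψ ⦆ x) ^[0]
    ⟦ □ φ ⟧       = R□^[0] ⦅ φ ⦆
    ⟦ ◇ φ ⟧       = R◇^[0] ⟦ φ ⟧ ^[0]

    ⦅ ⊥ ⦆         = λ _ → 𝟏
    ⦅ ⊤ ⦆         = ⟦ ⊤ ⟧ ^[1]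
    ⦅ var p ⦆     = int p
    ⦅ φ ∧ ψ ⦆     = ⟦ φ ∧ ψ ⟧ ^[1]
    ⦅ φ ∨ ψ ⦆     = λ x → ⦅ φ ⦆ x ⊓ ⦅ ψ ⦆ x
    ⦅ □ φ ⦆       = ⟦ □ φ ⟧ ^[1]
    ⦅ ◇ φ ⦆       = R◇^[0] ⟦ φ ⟧

    True : Sequent Atom → Set ℓ
    True (φ ⊢ ψ) = ⟦ φ ⟧ ⊆ ⟦ ψ ⟧

  infix 4 _⊩_

  _⊩_ : {Atom : Set} → Frame 𝐀 → Sequent Atom → Set ℓ
  _⊩_ {Atom} 𝔾 s = (V : Valuation Atom 𝔾) → True V s

  𝒦₀ : Set → Pred (Frame 𝐀) ℓ
  𝒦₀ Atom 𝔾 = 𝔾 ⊩ axiom₀ {Atom}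

  𝒦₁ : {Atom : Set} → Atom → Pred (Frame 𝐀) ℓ
  𝒦₁ p 𝔾 = 𝔾 ⊩ axiom₁ p

module Submission where

-- Completeness is constructive, over an arbitrary 𝐀.  An inequality 𝟏 ≤ 𝟎 in 𝐀
-- only refutes the underivability of φ ⊢ ψ, so derivability must be decidable;
-- this comes from a cut-free calculus in which □ has a left adjoint and ◇ a right
-- adjoint, both computed on formulas.  The points of the canonical frame are the
-- underivable sequents a ⊢ b, standing for the filter generated by a and the
-- ideal generated by b; E and the accessibility relations take only the values
-- 𝟎 and 𝟏.  The adjoints send such points to points of the same kind, which makes
-- the accessibility relations compatible with E and gives the frame conditions.

open import Defs
open import Data.Bool.Base using (Bool; true; false; T; if_then_else_)
open import Data.Bool.Properties using (T?)
open import Data.Empty using (⊥-elim) renaming (⊥ to Empty)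
open import Data.Nat.Base using (ℕ; zero; suc; _⊔_) renaming (_≤_ to _≤ⁿ_; s≤s to s≤ⁿs)
open import Data.Nat.Properties using (m≤m⊔n; m≤n⊔m; n≤1+n) renaming (_≟_ to _≟ⁿ_)
open import Data.Product using (_×_; _,_; proj₁; proj₂; ∃)
open import Data.Sum.Base using (_⊎_; inj₁; inj₂)
open import Data.Unit.Base using (tt) renaming (⊤ to Unit)
open import Function.Base using (flip)
open import Function.Bundles using (_⇔_; _↣_; mk⇔; Equivalence)
open import Level using (Level; 0ℓ)
open import Relation.Binary.Lattice.Structures using (IsBoundedLattice)
open import Relation.Binary.Definitions using (DecidableEquality)
open import Relation.Binary.PropositionalEquality using (_≡_; _≗_; refl; sym; trans; cong; cong₂; subst₂) renaming (subst to ≡-subst)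
open import Relation.Nullary using (¬_; Dec; yes; no; does)
open import Relation.Nullary.Decidable using (map′; _×-dec_; _⊎-dec_; via-injection)
open import Relation.Unary using (Pred; _∈_)

-- Formulas equivalent to a constant, modal adjoints, modal depth

module _ {Atom : Set} where

  -- Null φ and Full φ characterise φ ⊢ ⊥ and ⊤ ⊢ φ in both logics: they compute
  -- the value of φ in the two-element lattice when □ is the identity and, for
  -- Null, all atoms are true and ◇ is the identity; for Full, all atoms are false
  -- and ◇ is constantly false.
  Null : Fm Atom → Set
  Null ⊥       = Unit
  Null ⊤       = Empty
  Null (var _) = Empty
  Null (a ∧ b) = Null a ⊎ Null b
  Null (a ∨ b) = Null a × Null b
  Null (□ a)   = Null a
  Null (◇ a)   = Null a

  Full : Fm Atom → Set
  Full ⊥       = Empty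
  Full ⊤       = Unit
  Full (var _) = Empty
  Full (a ∧ b) = Full a × Full b
  Full (a ∨ b) = Full a ⊎ Full b
  Full (□ a)   = Full a
  Full (◇ a)   = Empty

  null? : ∀ φ → Dec (Null φ)
  null? ⊥       = yes tt
  null? ⊤       = no λ ()
  null? (var _) = no λ ()
  null? (a ∧ b) = null? a ⊎-dec null? b
  null? (a ∨ b) = null? a ×-dec null? b
  null? (□ a)   = null? a
  null? (◇ a)   = null? a

  full? : ∀ φ → Dec (Full φ)
  full? ⊥       = no λ ()
  full? ⊤       = yes tt
  full? (var _) = no λ ()
  full? (a ∧ b) = full? a ×-dec full? b
  full? (a ∨ b) = full? a ⊎-dec full? b
  full? (□ a)   = full? a
  full? (◇ a)   = no λ ()

  ¬null∧full : ∀ φ → Null φ → Full φ → Empty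
  ¬null∧full (a ∧ b) (inj₁ n) (f , _) = ¬null∧full a n f
  ¬null∧full (a ∧ b) (inj₂ n) (_ , f) = ¬null∧full b n f
  ¬null∧full (a ∨ b) (n , _) (inj₁ f) = ¬null∧full a n f
  ¬null∧full (a ∨ b) (_ , n) (inj₂ f) = ¬null∧full b n f
  ¬null∧full (□ a)   n f              = ¬null∧full a n f

  -- The adjoints unbox ⊣ □ and ◇ ⊣ undia with respect to derivability.  That
  -- unbox (□ a) can be a also in L₁ rests on a ⊢ unbox a (unboxʳ below).
  unbox : Fm Atom → Fm Atom
  unbox ⊥       = ⊥
  unbox ⊤       = ⊤
  unbox (var _) = ⊤
  unbox (a ∧ b) = unbox a ∧ unbox b
  unbox (a ∨ b) = unbox a ∨ unbox b
  unbox (□ a)   = a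
  unbox (◇ a)   = if does (null? a) then ⊥ else ⊤

  undia : Fm Atom → Fm Atom
  undia ⊥       = ⊥
  undia ⊤       = ⊤
  undia (var _) = ⊥
  undia (a ∧ b) = undia a ∧ undia b
  undia (a ∨ b) = undia a ∨ undia b
  undia (□ a)   = if does (full? a) then ⊤ else ⊥
  undia (◇ a)   = a

  null-unbox : ∀ φ → Null φ → Null (unbox φ)
  null-unbox ⊥       n        = tt
  null-unbox (a ∧ b) (inj₁ n) = inj₁ (null-unbox a n)
  null-unbox (a ∧ b) (inj₂ n) = inj₂ (null-unbox b n)
  null-unbox (a ∨ b) (m , n)  = null-unbox a m , null-unbox b n
  null-unbox (□ a)   n        = n
  null-unbox (◇ a)   n with null? a
  ... | yes _ = tt
  ... | no ¬n = ¬n n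

  null-unbox⁻ : ∀ φ → Null (unbox φ) → Null φ
  null-unbox⁻ ⊥       n        = tt
  null-unbox⁻ (a ∧ b) (inj₁ n) = inj₁ (null-unbox⁻ a n)
  null-unbox⁻ (a ∧ b) (inj₂ n) = inj₂ (null-unbox⁻ b n)
  null-unbox⁻ (a ∨ b) (m , n)  = null-unbox⁻ a m , null-unbox⁻ b n
  null-unbox⁻ (□ a)   n        = n
  null-unbox⁻ (◇ a)   n with null? a
  ... | yes m = m

  full-unbox : ∀ φ → Full φ → Full (unbox φ)
  full-unbox ⊤       f        = tt
  full-unbox (a ∧ b) (f , g)  = full-unbox a f , full-unbox b g
  full-unbox (a ∨ b) (inj₁ f) = inj₁ (full-unbox a f)
  full-unbox (a ∨ b) (inj₂ f) = inj₂ (full-unbox b f)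
  full-unbox (□ a)   f        = f

  null-undia : ∀ φ → Null φ → Null (undia φ)
  null-undia ⊥       n        = tt
  null-undia (a ∧ b) (inj₁ n) = inj₁ (null-undia a n)
  null-undia (a ∧ b) (inj₂ n) = inj₂ (null-undia b n)
  null-undia (a ∨ b) (m , n)  = null-undia a m , null-undia b n
  null-undia (□ a)   n with full? a
  ... | yes f = ¬null∧full a n f
  ... | no  _ = tt
  null-undia (◇ a)   n        = n

  full-undia : ∀ φ → Full φ → Full (undia φ)
  full-undia ⊤       f        = tt
  full-undia (a ∧ b) (f , g)  = full-undia a f , full-undia b g
  full-undia (a ∨ b) (inj₁ f) = inj₁ (full-undia a f)
  full-undia (a ∨ b) (inj₂ f) = inj₂ (full-undia b f)
  full-undia (□ a)   f with full? a
  ... | yes _ = tt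
  ... | no ¬f = ¬f f

  -- Up to constants, `undia` retains only diamonds and `unbox` only boxes, so at each leaf one of
  -- them is trivial, and the dichotomy passes through `∧` and `∨`. It settles the monotonicity of
  -- each adjoint under the rule of the other modality.
  null-undia⊎full-unbox : ∀ φ → Null (undia φ) ⊎ Full (unbox φ)
  null-undia⊎full-unbox ⊥       = inj₁ tt
  null-undia⊎full-unbox ⊤       = inj₂ tt
  null-undia⊎full-unbox (var _) = inj₁ tt
  null-undia⊎full-unbox (a ∧ b) with null-undia⊎full-unbox a | null-undia⊎full-unbox b
  ... | inj₁ n | _      = inj₁ (inj₁ n)
  ... | inj₂ _ | inj₁ n = inj₁ (inj₂ n)
  ... | inj₂ f | inj₂ g = inj₂ (f , g)
  null-undia⊎full-unbox (a ∨ b) with null-undia⊎full-unbox a | null-undia⊎full-unbox b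
  ... | inj₁ m | inj₁ n = inj₁ (m , n)
  ... | inj₁ _ | inj₂ g = inj₂ (inj₂ g)
  ... | inj₂ f | _      = inj₂ (inj₁ f)
  null-undia⊎full-unbox (□ a) with full? a
  ... | yes f = inj₂ f
  ... | no  _ = inj₁ tt
  null-undia⊎full-unbox (◇ a) with null? a
  ... | yes n = inj₁ n
  ... | no  _ = inj₂ tt

  -- Atoms count as modal, so that unbox and undia strictly lower the bound and
  -- formulas of depth 0 are built from ⊥ and ⊤ alone.
  data Depth≤ : ℕ → Fm Atom → Set where
    ⊥   : ∀ {n} → Depth≤ n ⊥
    ⊤   : ∀ {n} → Depth≤ n ⊤
    var : ∀ {n p} → Depth≤ (suc n) (var p)
    _∧_ : ∀ {n a b} → Depth≤ n a → Depth≤ n b → Depth≤ n (a ∧ b)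
    _∨_ : ∀ {n a b} → Depth≤ n a → Depth≤ n b → Depth≤ n (a ∨ b)
    □_  : ∀ {n a} → Depth≤ n a → Depth≤ (suc n) (□ a)
    ◇_  : ∀ {n a} → Depth≤ n a → Depth≤ (suc n) (◇ a)

  depth≤-mono : ∀ {m n φ} → m ≤ⁿ n → Depth≤ m φ → Depth≤ n φ
  depth≤-mono m≤n       ⊥       = ⊥
  depth≤-mono m≤n       ⊤       = ⊤
  depth≤-mono (s≤ⁿs _)   var     = var
  depth≤-mono m≤n       (a ∧ b) = depth≤-mono m≤n a ∧ depth≤-mono m≤n b
  depth≤-mono m≤n       (a ∨ b) = depth≤-mono m≤n a ∨ depth≤-mono m≤n b
  depth≤-mono (s≤ⁿs m≤n) (□ a)   = □ depth≤-mono m≤n a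
  depth≤-mono (s≤ⁿs m≤n) (◇ a)   = ◇ depth≤-mono m≤n a

  depth : Fm Atom → ℕ
  depth ⊥       = 0
  depth ⊤       = 0
  depth (var _) = 1
  depth (a ∧ b) = depth a ⊔ depth b
  depth (a ∨ b) = depth a ⊔ depth b
  depth (□ a)   = suc (depth a)
  depth (◇ a)   = suc (depth a)

  depth≤-depth : ∀ φ → Depth≤ (depth φ) φ
  depth≤-depth ⊥       = ⊥
  depth≤-depth ⊤       = ⊤
  depth≤-depth (var _) = var
  depth≤-depth (a ∧ b) = depth≤-mono (m≤m⊔n (depth a) (depth b)) (depth≤-depth a)
                       ∧ depth≤-mono (m≤n⊔m (depth a) (depth b)) (depth≤-depth b)
  depth≤-depth (a ∨ b) = depth≤-mono (m≤m⊔n (depth a) (depth b)) (depth≤-depth a)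
                       ∨ depth≤-mono (m≤n⊔m (depth a) (depth b)) (depth≤-depth b)
  depth≤-depth (□ a)   = □ depth≤-depth a
  depth≤-depth (◇ a)   = ◇ depth≤-depth a

  depth≤-suc : ∀ {n φ} → Depth≤ n φ → Depth≤ (suc n) φ
  depth≤-suc = depth≤-mono (n≤1+n _)

  depth≤-unbox : ∀ {n φ} → Depth≤ (suc n) φ → Depth≤ n (unbox φ)
  depth≤-unbox ⊥       = ⊥
  depth≤-unbox ⊤       = ⊤
  depth≤-unbox var     = ⊤
  depth≤-unbox (a ∧ b) = depth≤-unbox a ∧ depth≤-unbox b
  depth≤-unbox (a ∨ b) = depth≤-unbox a ∨ depth≤-unbox b
  depth≤-unbox (□ a)   = a
  depth≤-unbox (◇_ {a = a} _) with does (null? a)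
  ... | true  = ⊥
  ... | false = ⊤

  depth≤-undia : ∀ {n φ} → Depth≤ (suc n) φ → Depth≤ n (undia φ)
  depth≤-undia ⊥       = ⊥
  depth≤-undia ⊤       = ⊤
  depth≤-undia var     = ⊥
  depth≤-undia (a ∧ b) = depth≤-undia a ∧ depth≤-undia b
  depth≤-undia (a ∨ b) = depth≤-undia a ∨ depth≤-undia b
  depth≤-undia (□_ {a = a} _) with does (full? a)
  ... | true  = ⊤
  ... | false = ⊥
  depth≤-undia (◇ a)   = a

  depth0⇒null⊎full : ∀ {φ} → Depth≤ 0 φ → Null φ ⊎ Full φ
  depth0⇒null⊎full ⊥ = inj₁ tt
  depth0⇒null⊎full ⊤ = inj₂ tt
  depth0⇒null⊎full (a ∧ b) with depth0⇒null⊎full a | depth0⇒null⊎full b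
  ... | inj₁ n | _      = inj₁ (inj₁ n)
  ... | inj₂ _ | inj₁ n = inj₁ (inj₂ n)
  ... | inj₂ f | inj₂ g = inj₂ (f , g)
  depth0⇒null⊎full (a ∨ b) with depth0⇒null⊎full a | depth0⇒null⊎full b
  ... | inj₁ m | inj₁ n = inj₁ (m , n)
  ... | inj₁ _ | inj₂ g = inj₂ (inj₂ g)
  ... | inj₂ f | _      = inj₂ (inj₁ f)

  -- Composition of substitutions

  []-∘ : (τ σ : Atom → Fm Atom) → ∀ φ → φ [ τ ] [ σ ] ≡ φ [ (λ p → τ p [ σ ]) ]
  []-∘ τ σ ⊥       = refl
  []-∘ τ σ ⊤       = refl
  []-∘ τ σ (var _) = refl
  []-∘ τ σ (a ∧ b) = cong₂ _∧_ ([]-∘ τ σ a) ([]-∘ τ σ b)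
  []-∘ τ σ (a ∨ b) = cong₂ _∨_ ([]-∘ τ σ a) ([]-∘ τ σ b)
  []-∘ τ σ (□ a)   = cong □_ ([]-∘ τ σ a)
  []-∘ τ σ (◇ a)   = cong ◇_ ([]-∘ τ σ a)

  []ₛ-∘ : (τ σ : Atom → Fm Atom) → ∀ s → s [ τ ]ₛ [ σ ]ₛ ≡ s [ (λ p → τ p [ σ ]) ]ₛ
  []ₛ-∘ τ σ (φ ⊢ ψ) = cong₂ _⊢_ ([]-∘ τ σ φ) ([]-∘ τ σ ψ)

  []-var : (φ : Fm Atom) → φ [ var ] ≡ φ
  []-var ⊥       = refl
  []-var ⊤       = refl
  []-var (var _) = refl
  []-var (a ∧ b) = cong₂ _∧_ ([]-var a) ([]-var b)
  []-var (a ∨ b) = cong₂ _∨_ ([]-var a) ([]-var b)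
  []-var (□ a)   = cong □_ ([]-var a)
  []-var (◇ a)   = cong ◇_ ([]-var a)

-- The cut-free calculus and cut elimination

module CutFree (reflexive : Bool) {Atom : Set} where

  infix 3 _⟶_

  -- `□R` and `◇L` are the adjunctions read as rules, acting on the whole opposite formula at once;
  -- this absorbs `□-∧` and `◇-∨`. `null` and `full` cover `□ ⊥ ⊢ ⊥`, `◇ ⊥ ⊢ ⊥` and `⊤ ⊢ □ ⊤`.
  data _⟶_ : Fm Atom → Fm Atom → Set where
    null : ∀ {φ ψ} → Null φ → φ ⟶ ψ
    full : ∀ {φ ψ} → Full ψ → φ ⟶ ψ
    atom : ∀ {p} → var p ⟶ var p
    ∧L₁  : ∀ {a b ψ} → a ⟶ ψ → a ∧ b ⟶ ψ
    ∧L₂  : ∀ {a b ψ} → b ⟶ ψ → a ∧ b ⟶ ψ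
    ∧R   : ∀ {φ a b} → φ ⟶ a → φ ⟶ b → φ ⟶ a ∧ b
    ∨L   : ∀ {a b ψ} → a ⟶ ψ → b ⟶ ψ → a ∨ b ⟶ ψ
    ∨R₁  : ∀ {φ a b} → φ ⟶ a → φ ⟶ a ∨ b
    ∨R₂  : ∀ {φ a b} → φ ⟶ b → φ ⟶ a ∨ b
    □L   : ∀ {a ψ} → T reflexive → a ⟶ ψ → □ a ⟶ ψ
    □R   : ∀ {φ a} → unbox φ ⟶ a → φ ⟶ □ a
    ◇L   : ∀ {a ψ} → a ⟶ undia ψ → ◇ a ⟶ ψ

  ⟶-refl : ∀ φ → φ ⟶ φ
  ⟶-refl ⊥       = null tt
  ⟶-refl ⊤       = full tt
  ⟶-refl (var _) = atom
  ⟶-refl (a ∧ b) = ∧R (∧L₁ (⟶-refl a)) (∧L₂ (⟶-refl b))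
  ⟶-refl (a ∨ b) = ∨L (∨R₁ (⟶-refl a)) (∨R₂ (⟶-refl b))
  ⟶-refl (□ a)   = □R (⟶-refl a)
  ⟶-refl (◇ a)   = ◇L (⟶-refl a)

  -- Contrapositive of soundness for the two-valued interpretation behind `Null`; `full-resp` is the
  -- direct form for the one behind `Full`.
  null-resp : ∀ {φ ψ} → φ ⟶ ψ → Null ψ → Null φ
  null-resp (null m)          n        = m
  null-resp (full {ψ = ψ} f)  n        = ⊥-elim (¬null∧full ψ n f)
  null-resp (∧L₁ d)           n        = inj₁ (null-resp d n)
  null-resp (∧L₂ d)           n        = inj₂ (null-resp d n)
  null-resp (∧R d e)          (inj₁ n) = null-resp d n
  null-resp (∧R d e)          (inj₂ n) = null-resp e n
  null-resp (∨L d e)          n        = null-resp d n , null-resp e n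
  null-resp (∨R₁ d)           (n , _)  = null-resp d n
  null-resp (∨R₂ d)           (_ , n)  = null-resp d n
  null-resp (□L _ d)          n        = null-resp d n
  null-resp (□R {φ} d)        n        = null-unbox⁻ φ (null-resp d n)
  null-resp (◇L {ψ = ψ} d)    n        = null-resp d (null-undia ψ n)

  full-resp : ∀ {φ ψ} → φ ⟶ ψ → Full φ → Full ψ
  full-resp (null {φ} n) f        = ⊥-elim (¬null∧full φ n f)
  full-resp (full g)     f        = g
  full-resp (∧L₁ d)      (f , _)  = full-resp d f
  full-resp (∧L₂ d)      (_ , f)  = full-resp d f
  full-resp (∧R d e)     f        = full-resp d f , full-resp e f
  full-resp (∨L d e)     (inj₁ f) = full-resp d f
  full-resp (∨L d e)     (inj₂ f) = full-resp e f
  full-resp (∨R₁ d)      f        = inj₁ (full-resp d f)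
  full-resp (∨R₂ d)      f        = inj₂ (full-resp d f)
  full-resp (□L _ d)     f        = full-resp d f
  full-resp (□R {φ} d)   f        = full-resp d (full-unbox φ f)

  ◇L⁻ : ∀ {a ψ} → a ⟶ undia ψ → Null a ⊎ Full (unbox ψ)
  ◇L⁻ {ψ = ψ} d with null-undia⊎full-unbox ψ
  ... | inj₁ n = inj₁ (null-resp d n)
  ... | inj₂ f = inj₂ f

  -- An admissible cut with `φ ⊢ unbox φ`, which holds since `φ ⊢ □ unbox φ` and the box may be
  -- dropped. The recursion is on the derivation.
  unboxˡ : T reflexive → ∀ φ {ψ} → unbox φ ⟶ ψ → φ ⟶ ψ
  unboxˡ r ⊥       d = d
  unboxˡ r ⊤       d = d
  unboxˡ r (var _) d = full (full-resp d tt)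
  unboxˡ r (□ a)   d = □L r d
  unboxˡ r (◇ a)   d with null? a
  ... | yes n = null n
  ... | no  _ = full (full-resp d tt)
  unboxˡ r (a ∧ b) (null n)  = null (null-unbox⁻ (a ∧ b) n)
  unboxˡ r (a ∧ b) (full f)  = full f
  unboxˡ r (a ∧ b) (∧L₁ d)   = ∧L₁ (unboxˡ r a d)
  unboxˡ r (a ∧ b) (∧L₂ d)   = ∧L₂ (unboxˡ r b d)
  unboxˡ r (a ∧ b) (∧R d e)  = ∧R (unboxˡ r (a ∧ b) d) (unboxˡ r (a ∧ b) e)
  unboxˡ r (a ∧ b) (∨R₁ d)   = ∨R₁ (unboxˡ r (a ∧ b) d)
  unboxˡ r (a ∧ b) (∨R₂ d)   = ∨R₂ (unboxˡ r (a ∧ b) d)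
  -- The premise starts from `unbox (unbox (a ∧ b))`, so reflexivity removes one `unbox` and `□R`
  -- the other.
  unboxˡ r (a ∧ b) (□R d)    = □R (unboxˡ r (unbox (a ∧ b)) d)
  unboxˡ r (a ∨ b) (null n)  = null (null-unbox⁻ (a ∨ b) n)
  unboxˡ r (a ∨ b) (full f)  = full f
  unboxˡ r (a ∨ b) (∨L d e)  = ∨L (unboxˡ r a d) (unboxˡ r b e)
  unboxˡ r (a ∨ b) (∧R d e)  = ∧R (unboxˡ r (a ∨ b) d) (unboxˡ r (a ∨ b) e)
  unboxˡ r (a ∨ b) (∨R₁ d)   = ∨R₁ (unboxˡ r (a ∨ b) d)
  unboxˡ r (a ∨ b) (∨R₂ d)   = ∨R₂ (unboxˡ r (a ∨ b) d)
  unboxˡ r (a ∨ b) (□R d)    = □R (unboxˡ r (unbox (a ∨ b)) d)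

  unboxʳ : T reflexive → ∀ {φ ψ} → φ ⟶ ψ → φ ⟶ unbox ψ
  unboxʳ r (null n)         = null n
  unboxʳ r (full {ψ = ψ} f) = full (full-unbox ψ f)
  unboxʳ r atom             = full tt
  unboxʳ r (∧L₁ d)          = ∧L₁ (unboxʳ r d)
  unboxʳ r (∧L₂ d)          = ∧L₂ (unboxʳ r d)
  unboxʳ r (∧R d e)         = ∧R (unboxʳ r d) (unboxʳ r e)
  unboxʳ r (∨L d e)         = ∨L (unboxʳ r d) (unboxʳ r e)
  unboxʳ r (∨R₁ d)          = ∨R₁ (unboxʳ r d)
  unboxʳ r (∨R₂ d)          = ∨R₂ (unboxʳ r d)
  unboxʳ r (□L _ d)         = □L r (unboxʳ r d)
  unboxʳ r (□R {φ} d)       = unboxˡ r φ d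
  unboxʳ r (◇L {ψ = ψ} d) with ◇L⁻ {ψ = ψ} d
  ... | inj₁ n = null n
  ... | inj₂ f = full f

  -- At `ψ = □ b` this inverts `□R`; the two together are the adjunction `unbox ⊣ □`.
  unbox-mono : ∀ {φ ψ} → φ ⟶ ψ → unbox φ ⟶ unbox ψ
  unbox-mono (null {φ} n)     = null (null-unbox φ n)
  unbox-mono (full {ψ = ψ} f) = full (full-unbox ψ f)
  unbox-mono atom             = full tt
  unbox-mono (∧L₁ d)          = ∧L₁ (unbox-mono d)
  unbox-mono (∧L₂ d)          = ∧L₂ (unbox-mono d)
  unbox-mono (∧R d e)         = ∧R (unbox-mono d) (unbox-mono e)
  unbox-mono (∨L d e)         = ∨L (unbox-mono d) (unbox-mono e)
  unbox-mono (∨R₁ d)          = ∨R₁ (unbox-mono d)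
  unbox-mono (∨R₂ d)          = ∨R₂ (unbox-mono d)
  unbox-mono (□L r d)         = unboxʳ r d
  unbox-mono (□R d)           = d
  unbox-mono (◇L {a} {ψ} d) with ◇L⁻ {ψ = ψ} d
  ... | inj₁ n = null (null-unbox (◇ a) n)
  ... | inj₂ f = full f

  -- At `φ = ◇ a` this inverts `◇L`; the two together are the adjunction `◇ ⊣ undia`.
  undia-mono : ∀ {φ ψ} → φ ⟶ ψ → undia φ ⟶ undia ψ
  undia-mono (null {φ} n)     = null (null-undia φ n)
  undia-mono (full {ψ = ψ} f) = full (full-undia ψ f)
  undia-mono atom             = null tt
  undia-mono (∧L₁ d)          = ∧L₁ (undia-mono d)
  undia-mono (∧L₂ d)          = ∧L₂ (undia-mono d)
  undia-mono (∧R d e)         = ∧R (undia-mono d) (undia-mono e)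
  undia-mono (∨L d e)         = ∨L (undia-mono d) (undia-mono e)
  undia-mono (∨R₁ d)          = ∨R₁ (undia-mono d)
  undia-mono (∨R₂ d)          = ∨R₂ (undia-mono d)
  undia-mono (□L {a} {ψ} r d) with full? a
  ... | yes f = full (full-undia ψ (full-resp d f))
  ... | no  _ = null tt
  -- Either `undia φ` is null, or `unbox φ` is full, which forces `a` and with it `undia (□ a)` to
  -- be full.
  undia-mono (□R {φ} {a} d) with null-undia⊎full-unbox φ
  ... | inj₁ n = null n
  ... | inj₂ f = full (full-undia (□ a) (full-resp d f))
  undia-mono (◇L d)           = d

  -- Inversion lets a cut against `∧L₁` recurse on the right derivation, whatever the left one is.
  ∧R⁻₁ : ∀ {φ a b} → φ ⟶ a ∧ b → φ ⟶ a
  ∧R⁻₁ (null n)   = null n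
  ∧R⁻₁ (full f)   = full (proj₁ f)
  ∧R⁻₁ (∧L₁ d)    = ∧L₁ (∧R⁻₁ d)
  ∧R⁻₁ (∧L₂ d)    = ∧L₂ (∧R⁻₁ d)
  ∧R⁻₁ (∧R d e)   = d
  ∧R⁻₁ (∨L d e)   = ∨L (∧R⁻₁ d) (∧R⁻₁ e)
  ∧R⁻₁ (□L r d)   = □L r (∧R⁻₁ d)
  ∧R⁻₁ (◇L d)     = ◇L (∧R⁻₁ d)

  ∧R⁻₂ : ∀ {φ a b} → φ ⟶ a ∧ b → φ ⟶ b
  ∧R⁻₂ (null n)   = null n
  ∧R⁻₂ (full f)   = full (proj₂ f)
  ∧R⁻₂ (∧L₁ d)    = ∧L₁ (∧R⁻₂ d)
  ∧R⁻₂ (∧L₂ d)    = ∧L₂ (∧R⁻₂ d)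
  ∧R⁻₂ (∧R d e)   = e
  ∧R⁻₂ (∨L d e)   = ∨L (∧R⁻₂ d) (∧R⁻₂ e)
  ∧R⁻₂ (□L r d)   = □L r (∧R⁻₂ d)
  ∧R⁻₂ (◇L d)     = ◇L (∧R⁻₂ d)

  -- Lexicographic recursion: the depth of the cut formula, the right derivation,
  -- the left derivation.  The depth is needed because unbox-mono and undia-mono
  -- replace derivations by new ones.
  cut-depth : ∀ n {φ ψ χ} → Depth≤ n ψ → φ ⟶ ψ → ψ ⟶ χ → φ ⟶ χ
  cut-depth zero k d e with depth0⇒null⊎full k
  ... | inj₁ n = null (null-resp d n)
  ... | inj₂ f = full (full-resp e f)
  cut-depth (suc n) k       d         (null m)   = null (null-resp d m)
  cut-depth (suc n) k       d         (full f)   = full f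
  cut-depth (suc n) k       d         atom       = d
  cut-depth (suc n) (k ∧ l) d         (∧L₁ e)    = cut-depth (suc n) k (∧R⁻₁ d) e
  cut-depth (suc n) (k ∧ l) d         (∧L₂ e)    = cut-depth (suc n) l (∧R⁻₂ d) e
  cut-depth (suc n) k       d         (∧R e f)   = ∧R (cut-depth (suc n) k d e) (cut-depth (suc n) k d f)
  cut-depth (suc n) k       d         (∨R₁ e)    = ∨R₁ (cut-depth (suc n) k d e)
  cut-depth (suc n) k       d         (∨R₂ e)    = ∨R₂ (cut-depth (suc n) k d e)
  cut-depth (suc n) k       d         (□R e)     = □R (cut-depth n (depth≤-unbox k) (unbox-mono d) e)
  -- As `unbox (□ a)` is `a`, the cut is made below the box at smaller depth; reflexivity then drops
  -- `unbox`.
  cut-depth (suc n) (□ k)   d         (□L r e)   = unboxˡ r _ (cut-depth n k (unbox-mono d) e)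
  -- With `∨L` or `◇L` last on the right, the cut formula is principal there, so the left derivation
  -- is analysed.
  cut-depth (suc n) k       (null m)  e@(∨L _ _) = null m
  cut-depth (suc n) k       (full f)  e@(∨L _ _) = full (full-resp e f)
  cut-depth (suc n) k       (∧L₁ d)   e@(∨L _ _) = ∧L₁ (cut-depth (suc n) k d e)
  cut-depth (suc n) k       (∧L₂ d)   e@(∨L _ _) = ∧L₂ (cut-depth (suc n) k d e)
  cut-depth (suc n) k       (∨L d d′) e@(∨L _ _) = ∨L (cut-depth (suc n) k d e) (cut-depth (suc n) k d′ e)
  cut-depth (suc n) (k ∨ l) (∨R₁ d)   (∨L e _)   = cut-depth (suc n) k d e
  cut-depth (suc n) (k ∨ l) (∨R₂ d)   (∨L _ e)   = cut-depth (suc n) l d e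
  cut-depth (suc n) k       (□L r d)  e@(∨L _ _) = □L r (cut-depth (suc n) k d e)
  cut-depth (suc n) k       (◇L d)    e@(∨L _ _) = ◇L (cut-depth n (depth≤-undia k) d (undia-mono e))
  cut-depth (suc n) k       (null m)  e@(◇L _)   = null m
  cut-depth (suc n) k       (∧L₁ d)   e@(◇L _)   = ∧L₁ (cut-depth (suc n) k d e)
  cut-depth (suc n) k       (∧L₂ d)   e@(◇L _)   = ∧L₂ (cut-depth (suc n) k d e)
  cut-depth (suc n) k       (∨L d d′) e@(◇L _)   = ∨L (cut-depth (suc n) k d e) (cut-depth (suc n) k d′ e)
  cut-depth (suc n) k       (□L r d)  e@(◇L _)   = □L r (cut-depth (suc n) k d e)
  cut-depth (suc n) (◇ k)   (◇L d)    (◇L e)     = ◇L (cut-depth n k d e)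

  ⟶-trans : ∀ {φ ψ χ} → φ ⟶ ψ → ψ ⟶ χ → φ ⟶ χ
  ⟶-trans {ψ = ψ} = cut-depth (depth ψ) (depth≤-depth ψ)

  -- Decidability by backward proof search

  Left : Fm Atom → Fm Atom → Set
  Left ⊥       ψ = Empty
  Left ⊤       ψ = Empty
  Left (var p) ψ = ψ ≡ var p
  Left (a ∧ b) ψ = (a ⟶ ψ) ⊎ (b ⟶ ψ)
  Left (a ∨ b) ψ = (a ⟶ ψ) × (b ⟶ ψ)
  Left (□ a)   ψ = T reflexive × (a ⟶ ψ)
  Left (◇ a)   ψ = a ⟶ undia ψ

  Right : Fm Atom → Fm Atom → Set
  Right φ ⊥       = Empty
  Right φ ⊤       = Empty
  Right φ (var p) = Empty
  Right φ (a ∧ b) = (φ ⟶ a) × (φ ⟶ b)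
  Right φ (a ∨ b) = (φ ⟶ a) ⊎ (φ ⟶ b)
  Right φ (□ a)   = unbox φ ⟶ a
  Right φ (◇ a)   = Empty

  left : ∀ φ {ψ} → Left φ ψ → φ ⟶ ψ
  left (var p) refl     = atom
  left (a ∧ b) (inj₁ d) = ∧L₁ d
  left (a ∧ b) (inj₂ d) = ∧L₂ d
  left (a ∨ b) (d , e)  = ∨L d e
  left (□ a)   (r , d)  = □L r d
  left (◇ a)   d        = ◇L d

  right : ∀ {φ} ψ → Right φ ψ → φ ⟶ ψ
  right (a ∧ b) (d , e)  = ∧R d e
  right (a ∨ b) (inj₁ d) = ∨R₁ d
  right (a ∨ b) (inj₂ d) = ∨R₂ d
  right (□ a)   d        = □R d

  fromLastRule : ∀ {φ ψ} → Null φ ⊎ Full ψ ⊎ Left φ ψ ⊎ Right φ ψ → φ ⟶ ψ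
  fromLastRule         (inj₁ n)               = null n
  fromLastRule         (inj₂ (inj₁ f))        = full f
  fromLastRule {φ}     (inj₂ (inj₂ (inj₁ d))) = left φ d
  fromLastRule {ψ = ψ} (inj₂ (inj₂ (inj₂ d))) = right ψ d

  lastRule : ∀ {φ ψ} → φ ⟶ ψ → Null φ ⊎ Full ψ ⊎ Left φ ψ ⊎ Right φ ψ
  lastRule (null n)  = inj₁ n
  lastRule (full f)  = inj₂ (inj₁ f)
  lastRule atom      = inj₂ (inj₂ (inj₁ refl))
  lastRule (∧L₁ d)   = inj₂ (inj₂ (inj₁ (inj₁ d)))
  lastRule (∧L₂ d)   = inj₂ (inj₂ (inj₁ (inj₂ d)))
  lastRule (∧R d e)  = inj₂ (inj₂ (inj₂ (d , e)))
  lastRule (∨L d e)  = inj₂ (inj₂ (inj₁ (d , e)))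
  lastRule (∨R₁ d)   = inj₂ (inj₂ (inj₂ (inj₁ d)))
  lastRule (∨R₂ d)   = inj₂ (inj₂ (inj₂ (inj₂ d)))
  lastRule (□L r d)  = inj₂ (inj₂ (inj₁ (r , d)))
  lastRule (□R d)    = inj₂ (inj₂ (inj₂ d))
  lastRule (◇L d)    = inj₂ (inj₂ (inj₁ d))

  module _ (_≟_ : DecidableEquality Atom) where

    _≟var_ : (ψ : Fm Atom) (p : Atom) → Dec (ψ ≡ var p)
    ⊥       ≟var p = no λ ()
    ⊤       ≟var p = no λ ()
    var q   ≟var p = map′ (cong var) (λ { refl → refl }) (q ≟ p)
    (_ ∧ _) ≟var p = no λ ()
    (_ ∨ _) ≟var p = no λ ()
    (□ _)   ≟var p = no λ ()
    (◇ _)   ≟var p = no λ ()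

    mutual
      -- Lexicographic recursion on the depth bound and the two formulas: `unbox` and `undia` need
      -- not give subformulas but lower the bound, while every other premise shrinks one formula
      -- under the same bound.
      decide : ∀ n {φ ψ} → Depth≤ n φ → Depth≤ n ψ → Dec (φ ⟶ ψ)
      decide n {φ} {ψ} k l = map′ fromLastRule lastRule
        (null? φ ⊎-dec full? ψ ⊎-dec decideLeft n k l ⊎-dec decideRight n k l)

      decideLeft : ∀ n {φ ψ} → Depth≤ n φ → Depth≤ n ψ → Dec (Left φ ψ)
      decideLeft n       ⊥        l = no λ ()
      decideLeft n       ⊤        l = no λ ()
      decideLeft n       var      l = _ ≟var _
      decideLeft n       (k ∧ k′) l = decide n k l ⊎-dec decide n k′ l
      decideLeft n       (k ∨ k′) l = decide n k l ×-dec decide n k′ l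
      -- `ψ` may still need the whole bound, so only the left formula shrinks.
      decideLeft (suc n) (□ k)    l = T? reflexive ×-dec decide (suc n) (depth≤-suc k) l
      decideLeft (suc n) (◇ k)    l = decide n k (depth≤-undia l)

      decideRight : ∀ n {φ ψ} → Depth≤ n φ → Depth≤ n ψ → Dec (Right φ ψ)
      decideRight n       k ⊥        = no λ ()
      decideRight n       k ⊤        = no λ ()
      decideRight n       k var      = no λ ()
      decideRight n       k (l ∧ l′) = decide n k l ×-dec decide n k l′
      decideRight n       k (l ∨ l′) = decide n k l ⊎-dec decide n k l′
      decideRight (suc n) k (□ l)    = decide n (depth≤-unbox k) l
      decideRight (suc n) k (◇ l)    = no λ ()

    _⟶?_ : ∀ φ ψ → Dec (φ ⟶ ψ)
    φ ⟶? ψ = decide (depth φ ⊔ depth ψ)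
      (depth≤-mono (m≤m⊔n (depth φ) (depth ψ)) (depth≤-depth φ))
      (depth≤-mono (m≤n⊔m (depth φ) (depth ψ)) (depth≤-depth ψ))

  -- Equivalence of the calculus with the logics

  CutFree : Pred (Sequent Atom) 0ℓ
  CutFree (φ ⊢ ψ) = φ ⟶ ψ

  module _ {Ax : Pred (Sequent Atom) 0ℓ} where

    private
      _⊢ᴸ_ : Fm Atom → Fm Atom → Set
      φ ⊢ᴸ ψ = Logic Ax (φ ⊢ ψ)

    -- Treating all substitution instances at once turns the rule `subst` into composition of
    -- substitutions.
    logic⇒cutFree-[] : (∀ s → s ∈ Ax → ∀ σ → CutFree (s [ σ ]ₛ)) →
                       ∀ {s} → Logic Ax s → ∀ σ → CutFree (s [ σ ]ₛ)
    logic⇒cutFree-[] ax = go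
      where
      go : ∀ {s} → Logic Ax s → ∀ σ → CutFree (s [ σ ]ₛ)
      go (axiom s∈Ax)      σ = ax _ s∈Ax σ
      go id                σ = ⟶-refl _
      go ⊥-out             σ = null tt
      go ⊤-in              σ = full tt
      go ∨-inˡ             σ = ∨R₁ (⟶-refl _)
      go ∨-inʳ             σ = ∨R₂ (⟶-refl _)
      go ∧-outˡ            σ = ∧L₁ (⟶-refl _)
      go ∧-outʳ            σ = ∧L₂ (⟶-refl _)
      go □-⊤               σ = full tt
      -- `unbox (□ p ∧ □ q)` computes to `p ∧ q`, and for `◇-∨` likewise `undia (◇ p ∨ ◇ q)` to
      -- `p ∨ q`.
      go □-∧               σ = □R (⟶-refl _)
      go ◇-⊥               σ = null tt
      go ◇-∨               σ = ◇L (⟶-refl _)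
      go (cut d e)         σ = ⟶-trans (go d σ) (go e σ)
      go (subst {s} τ d)   σ = ≡-subst CutFree (sym ([]ₛ-∘ τ σ s)) (go d _)
      go (∧-in d e)        σ = ∧R (go d σ) (go e σ)
      go (∨-out d e)       σ = ∨L (go d σ) (go e σ)
      go (□-mono d)        σ = □R (go d σ)
      go (◇-mono d)        σ = ◇L (go d σ)

    logic⇒cutFree : (∀ s → s ∈ Ax → ∀ σ → CutFree (s [ σ ]ₛ)) →
                    ∀ {φ ψ} → φ ⊢ᴸ ψ → φ ⟶ ψ
    logic⇒cutFree ax {φ} {ψ} d =
      subst₂ _⟶_ ([]-var φ) ([]-var ψ) (logic⇒cutFree-[] ax d var)

    module _ (□⊥⊢⊥ : (□ ⊥) ⊢ᴸ ⊥) (□⊢ : T reflexive → ∀ a → (□ a) ⊢ᴸ a) where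

      null⇒logic : ∀ φ → Null φ → φ ⊢ᴸ ⊥
      null⇒logic ⊥       n        = id
      null⇒logic (a ∧ b) (inj₁ n) = cut ∧-outˡ (null⇒logic a n)
      null⇒logic (a ∧ b) (inj₂ n) = cut ∧-outʳ (null⇒logic b n)
      null⇒logic (a ∨ b) (m , n)  = ∨-out (null⇒logic a m) (null⇒logic b n)
      null⇒logic (□ a)   n        = cut (□-mono (null⇒logic a n)) □⊥⊢⊥
      null⇒logic (◇ a)   n        = cut (◇-mono (null⇒logic a n)) ◇-⊥

      full⇒logic : ∀ ψ → Full ψ → ⊤ ⊢ᴸ ψ
      full⇒logic ⊤       f        = id
      full⇒logic (a ∧ b) (f , g)  = ∧-in (full⇒logic a f) (full⇒logic b g)
      full⇒logic (a ∨ b) (inj₁ f) = cut (full⇒logic a f) ∨-inˡ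
      full⇒logic (a ∨ b) (inj₂ f) = cut (full⇒logic b f) ∨-inʳ
      full⇒logic (□ a)   f        = cut □-⊤ (□-mono (full⇒logic a f))

      -- The unit of `unbox ⊣ □`: followed by `□-mono` it simulates `□R`. Dually, `undia-counit`
      -- simulates `◇L`.
      unbox-unit : ∀ φ → φ ⊢ᴸ (□ unbox φ)
      unbox-unit ⊥       = ⊥-out
      unbox-unit ⊤       = □-⊤
      unbox-unit (var _) = cut ⊤-in □-⊤
      unbox-unit (a ∧ b) = cut (∧-in (cut ∧-outˡ (unbox-unit a)) (cut ∧-outʳ (unbox-unit b))) □-∧
      unbox-unit (a ∨ b) = ∨-out (cut (unbox-unit a) (□-mono ∨-inˡ)) (cut (unbox-unit b) (□-mono ∨-inʳ))
      unbox-unit (□ a)   = id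
      unbox-unit (◇ a) with null? a
      ... | yes n = cut (null⇒logic (◇ a) n) ⊥-out
      ... | no  _ = cut ⊤-in □-⊤

      undia-counit : ∀ ψ → (◇ undia ψ) ⊢ᴸ ψ
      undia-counit ⊥       = ◇-⊥
      undia-counit ⊤       = ⊤-in
      undia-counit (var _) = cut ◇-⊥ ⊥-out
      undia-counit (a ∧ b) = ∧-in (cut (◇-mono ∧-outˡ) (undia-counit a)) (cut (◇-mono ∧-outʳ) (undia-counit b))
      undia-counit (a ∨ b) = cut ◇-∨ (∨-out (cut (undia-counit a) ∨-inˡ) (cut (undia-counit b) ∨-inʳ))
      undia-counit (□ a) with full? a
      ... | yes f = cut ⊤-in (full⇒logic (□ a) f)
      ... | no  _ = cut ◇-⊥ ⊥-out
      undia-counit (◇ a)   = id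

      cutFree⇒logic : ∀ {φ ψ} → φ ⟶ ψ → φ ⊢ᴸ ψ
      cutFree⇒logic (null {φ} n)      = cut (null⇒logic φ n) ⊥-out
      cutFree⇒logic (full {ψ = ψ} f)  = cut ⊤-in (full⇒logic ψ f)
      cutFree⇒logic atom              = id
      cutFree⇒logic (∧L₁ d)           = cut ∧-outˡ (cutFree⇒logic d)
      cutFree⇒logic (∧L₂ d)           = cut ∧-outʳ (cutFree⇒logic d)
      cutFree⇒logic (∧R d e)          = ∧-in (cutFree⇒logic d) (cutFree⇒logic e)
      cutFree⇒logic (∨L d e)          = ∨-out (cutFree⇒logic d) (cutFree⇒logic e)
      cutFree⇒logic (∨R₁ d)           = cut (cutFree⇒logic d) ∨-inˡ
      cutFree⇒logic (∨R₂ d)           = cut (cutFree⇒logic d) ∨-inʳ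
      cutFree⇒logic (□L r d)          = cut (□⊢ r _) (cutFree⇒logic d)
      cutFree⇒logic (□R {φ} d)        = cut (unbox-unit φ) (□-mono (cutFree⇒logic d))
      cutFree⇒logic (◇L {ψ = ψ} d)    = cut (◇-mono (cutFree⇒logic d)) (undia-counit ψ)

-- Polars of lattice-valued relations

module Polarity {ℓ : Level} (𝐀 : TruthValues ℓ) where

  open TruthValues 𝐀 hiding (_∨_; _∧_) renaming (Carrier to A)
  open IsBoundedLattice isBoundedLattice public
    using (maximum; minimum; antisym; x∧y≤x; x∧y≤y; ∧-greatest)
    renaming (refl to ≤-refl; trans to ≤-trans; reflexive to ≤-reflexive)
  open Pointwise 𝐀

  ≤⇒ : ∀ {x y k} → x ⊗ y ≤ k → x ≤ y ⇒ k
  ≤⇒ = Equivalence.to (residuation _ _ _)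

  ⊗≤ : ∀ {x y k} → x ≤ y ⇒ k → x ⊗ y ≤ k
  ⊗≤ = Equivalence.from (residuation _ _ _)

  ⇒-swap : ∀ {x y k} → x ≤ y ⇒ k → y ≤ x ⇒ k
  ⇒-swap p = ≤⇒ (≤-trans (≤-reflexive (⊗-comm _ _)) (⊗≤ p))

  ⇒-monoʳ : ∀ {y k l} → k ≤ l → y ⇒ k ≤ y ⇒ l
  ⇒-monoʳ p = ≤⇒ (≤-trans (⊗≤ ≤-refl) p)

  ⇒-monoˡ : ∀ {x y k} → x ≤ y → y ⇒ k ≤ x ⇒ k
  ⇒-monoˡ p = ⇒-swap (≤-trans p (⇒-swap ≤-refl))

  -- Weakening: `k ≤ 𝟏 ⇒ k` swaps into `𝟏 ≤ k ⇒ k`, and `y ≤ 𝟏`.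
  k≤y⇒k : ∀ {y k} → k ≤ y ⇒ k
  k≤y⇒k = ⇒-swap (≤-trans (maximum _) (⇒-swap (≤-reflexive (sym (𝟏-⇒ _)))))

  𝟏≤k⇒x≤y⇒k : ∀ {x y k} → 𝟏 ≤ k → x ≤ y ⇒ k
  𝟏≤k⇒x≤y⇒k p = ≤-trans (maximum _) (≤-trans p k≤y⇒k)

  x≤𝟎⇒k : ∀ {x k} → x ≤ 𝟎 ⇒ k
  x≤𝟎⇒k = ⇒-swap (minimum _)

  ⊆-trans : {W : Set ℓ} {f g h : W → A} → f ⊆ g → g ⊆ h → f ⊆ h
  ⊆-trans p q w = ≤-trans (p w) (q w)

  infixr 9 _▷_

  -- The polar of `u` under `K`. All six maps of a graph have this form, with `K` or its flip
  -- sending `z` and `(α , z′)` to the residual of a relation value into `α`.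
  _▷_ : {W X : Set ℓ} → (W → X → A) → (X → A) → W → A
  (K ▷ u) w = ⋀ λ x → u x ⇒ K w x

  module _ {W X : Set ℓ} (K : W → X → A) where

    galois : {f : W → A} {u : X → A} → f ⊆ K ▷ u → u ⊆ flip K ▷ f
    galois p x = ⋀-greatest _ _ λ w → ⇒-swap (≤-trans (p w) (⋀-lower _ x))

    ▷-anti : {u v : X → A} → u ⊆ v → K ▷ v ⊆ K ▷ u
    ▷-anti p w = ⋀-greatest _ _ λ x → ≤-trans (⋀-lower _ x) (⇒-monoˡ (p x))

    ▷-unit : (u : X → A) → u ⊆ flip K ▷ K ▷ u
    ▷-unit u = galois (λ _ → ≤-refl)

    ▷-⁅⁆-≤ : ∀ β x w → (K ▷ ⁅ β / x ⁆) w ≤ β ⇒ K w x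
    ▷-⁅⁆-≤ β x w = ≤-trans (⋀-lower _ x) (⇒-monoˡ (⋁-upper _ refl))

    ▷-⁅⁆-≥ : ∀ β x w → β ⇒ K w x ≤ (K ▷ ⁅ β / x ⁆) w
    ▷-⁅⁆-≥ β x w = ⋀-greatest _ _ λ x′ → ⇒-swap (⋁-least _ _ λ { refl → ⇒-swap ≤-refl })

  module _ {W X : Set ℓ} (I K : W → X → A) where

    Stable : (X → A) → Set ℓ
    Stable u = I ▷ flip I ▷ K ▷ u ⊆ K ▷ u

    -- `K ▷ u` is the meet of the polars of the singletons `⁅ u x / x ⁆`, and closed maps are stable
    -- under meets.
    stable-⁅⁆⇒stable : (∀ β x → Stable ⁅ β / x ⁆) → ∀ u → Stable u
    stable-⁅⁆⇒stable st u w = ⋀-greatest _ _ λ x →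
      ≤-trans (▷-anti I (▷-anti (flip I) (▷-anti K (⁅⁆⊆u x))) w)
        (≤-trans (st (u x) x w) (▷-⁅⁆-≤ K (u x) x w))
      where
      ⁅⁆⊆u : ∀ x → ⁅ u x / x ⁆ ⊆ u
      ⁅⁆⊆u x x′ = ⋁-least _ _ λ { refl → ≤-refl }

    -- Where `K w x` is not already `𝟏`, some column of `I` dominates the column of `K` at `x` and
    -- does not exceed it at `w`; testing the closure at that column gives the bound at `w`.
    stable-⁅⁆ : (∀ w x → 𝟏 ≤ K w x ⊎ ∃ λ x′ → I w x′ ≤ K w x × (∀ w′ → K w′ x ≤ I w′ x′)) →
                ∀ β x → Stable ⁅ β / x ⁆
    stable-⁅⁆ col β x w with col w x
    ... | inj₁ p = ≤-trans (𝟏≤k⇒x≤y⇒k p) (▷-⁅⁆-≥ K β x w)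
    ... | inj₂ (x′ , Iwx′≤Kwx , Kx≤Ix′) =
      ≤-trans (⋀-lower _ x′)
        (≤-trans (⇒-monoˡ β≤)
          (≤-trans (⇒-monoʳ Iwx′≤Kwx) (▷-⁅⁆-≥ K β x w)))
      where
      β≤ : β ≤ (flip I ▷ K ▷ ⁅ β / x ⁆) x′
      β≤ = ⋀-greatest _ _ λ w′ → ⇒-swap (≤-trans (▷-⁅⁆-≤ K β x w′) (⇒-monoʳ (Kx≤Ix′ w′)))

  module _ {W X : Set ℓ} (I K : W → X → A) where

    -- For `K = I□`, `I ▷ flip K ▷ f` is the left adjoint of the semantic box. Having a left adjoint
    -- makes the box preserve meets, whence `□-⊤` and `□-∧`; the flipped instance serves `◇`.
    ⊆-▷ : (∀ f → Stable (flip I) (flip K) f) →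
          {f h : W → A} → I ▷ flip K ▷ f ⊆ h → f ⊆ K ▷ flip I ▷ h
    ⊆-▷ st {f} p = galois (flip K) (⊆-trans (▷-anti (flip I) p) (st f))

-- Soundness on graph-based frames

module Soundness {ℓ : Level} {𝐀 : TruthValues ℓ} (𝔾 : Frame 𝐀) where

  open TruthValues 𝐀 using (_⇒_) renaming (Carrier to A)
  open Pointwise 𝐀
  open Polarity 𝐀
  open Frame 𝔾

  I□ I◇ I : Z-A → Z-X → A
  I  z (α , z′) = E z z′ ⇒ α
  I□ z (α , z′) = R□ z z′ ⇒ α
  I◇ z (α , z′) = R◇ z′ z ⇒ α

  stable-R□^[0] : ∀ u → Stable I I□ u
  stable-R□^[0] = stable-⁅⁆⇒stable I I□ λ { β (α , z) → R□^[0]-stable z α β }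

  stable-R□^[1] : ∀ f → Stable (flip I) (flip I□) f
  stable-R□^[1] = stable-⁅⁆⇒stable (flip I) (flip I□) λ β z → R□^[1]-stable z β

  stable-R◇^[1] : ∀ u → Stable I I◇ u
  stable-R◇^[1] = stable-⁅⁆⇒stable I I◇ λ { β (α , z) → R◇^[1]-stable z α β }

  stable-R◇^[0] : ∀ f → Stable (flip I) (flip I◇) f
  stable-R◇^[0] = stable-⁅⁆⇒stable (flip I) (flip I◇) λ β z → R◇^[0]-stable z β

  module _ {Atom : Set} (V : Valuation Atom 𝔾) where

    open Valuation V

    mutual
      -- The two maps of every formula turn out to be each other's polars. Modal clauses are the
      -- extended frame conditions; `∧` and `∨` need the closedness of both components, hence the
      -- mutual recursion.
      ⟦⟧^[1]⊆⦅⦆ : ∀ φ → ⟦ V ⟧ φ ^[1] ⊆ ⦅ V ⦆ φ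
      ⟦⟧^[1]⊆⦅⦆ ⊥       x = maximum _
      ⟦⟧^[1]⊆⦅⦆ ⊤       x = ≤-refl
      ⟦⟧^[1]⊆⦅⦆ (var p) x = ≤-reflexive (ext^[1] p x)
      ⟦⟧^[1]⊆⦅⦆ (φ ∧ ψ) x = ≤-refl
      ⟦⟧^[1]⊆⦅⦆ (φ ∨ ψ) x = ∧-greatest
        (≤-trans (▷-anti (flip I) (▷-anti I (λ _ → x∧y≤x _ _)) x) (⦅⦆-closed φ x))
        (≤-trans (▷-anti (flip I) (▷-anti I (λ _ → x∧y≤y _ _)) x) (⦅⦆-closed ψ x))
      ⟦⟧^[1]⊆⦅⦆ (□ φ)   x = ≤-refl
      ⟦⟧^[1]⊆⦅⦆ (◇ φ)   x = stable-R◇^[0] _ x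

      ⦅⦆⊆⟦⟧^[1] : ∀ φ → ⦅ V ⦆ φ ⊆ ⟦ V ⟧ φ ^[1]
      ⦅⦆⊆⟦⟧^[1] ⊥       = ▷-unit I _
      ⦅⦆⊆⟦⟧^[1] ⊤       = λ _ → ≤-refl
      ⦅⦆⊆⟦⟧^[1] (var p) = λ x → ≤-reflexive (sym (ext^[1] p x))
      ⦅⦆⊆⟦⟧^[1] (φ ∧ ψ) = λ _ → ≤-refl
      ⦅⦆⊆⟦⟧^[1] (φ ∨ ψ) = ▷-unit I _
      ⦅⦆⊆⟦⟧^[1] (□ φ)   = λ _ → ≤-refl
      ⦅⦆⊆⟦⟧^[1] (◇ φ)   = ▷-unit I _

      ⦅⦆^[0]⊆⟦⟧ : ∀ φ → ⦅ V ⦆ φ ^[0] ⊆ ⟦ V ⟧ φ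
      ⦅⦆^[0]⊆⟦⟧ ⊥       z = ≤-refl
      ⦅⦆^[0]⊆⟦⟧ ⊤       z = maximum _
      ⦅⦆^[0]⊆⟦⟧ (var p) z = ≤-reflexive (int^[0] p z)
      ⦅⦆^[0]⊆⟦⟧ (φ ∧ ψ) z = ∧-greatest
        (≤-trans (▷-anti I (▷-anti (flip I) (λ _ → x∧y≤x _ _)) z) (⟦⟧-closed φ z))
        (≤-trans (▷-anti I (▷-anti (flip I) (λ _ → x∧y≤y _ _)) z) (⟦⟧-closed ψ z))
      ⦅⦆^[0]⊆⟦⟧ (φ ∨ ψ) z = ≤-refl
      ⦅⦆^[0]⊆⟦⟧ (□ φ)   z = stable-R□^[0] _ z
      ⦅⦆^[0]⊆⟦⟧ (◇ φ)   z = ≤-refl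

      ⟦⟧-closed : ∀ φ → ⟦ V ⟧ φ ^[10] ⊆ ⟦ V ⟧ φ
      ⟦⟧-closed φ = ⊆-trans (▷-anti I (⦅⦆⊆⟦⟧^[1] φ)) (⦅⦆^[0]⊆⟦⟧ φ)

      ⦅⦆-closed : ∀ φ → ⦅ V ⦆ φ ^[01] ⊆ ⦅ V ⦆ φ
      ⦅⦆-closed φ = ⊆-trans (▷-anti (flip I) (galois (flip I) (⦅⦆⊆⟦⟧^[1] φ))) (⟦⟧^[1]⊆⦅⦆ φ)

    ⟦⟧⊆⦅⦆^[0] : ∀ φ → ⟦ V ⟧ φ ⊆ ⦅ V ⦆ φ ^[0]
    ⟦⟧⊆⦅⦆^[0] φ = galois (flip I) (⦅⦆⊆⟦⟧^[1] φ)

    -- Reading every atom as `φ` turns validity of `□ p ⊢ p` into truth of `□ φ ⊢ φ` under `V`.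
    formula-valuation : Fm Atom → Valuation Atom 𝔾
    formula-valuation φ = record
      { ext     = λ _ → ⟦ V ⟧ φ
      ; int     = λ _ → ⦅ V ⦆ φ
      ; ext^[1] = λ _ x → antisym (⟦⟧^[1]⊆⦅⦆ φ x) (⦅⦆⊆⟦⟧^[1] φ x)
      ; int^[0] = λ _ z → antisym (⦅⦆^[0]⊆⟦⟧ φ z) (⟦⟧⊆⦅⦆^[0] φ z)
      }

    ⟦⟧⇒⦅⦆ : ∀ φ ψ → ⟦ V ⟧ φ ⊆ ⟦ V ⟧ ψ → ⦅ V ⦆ ψ ⊆ ⦅ V ⦆ φ
    ⟦⟧⇒⦅⦆ φ ψ p = ⊆-trans (⦅⦆⊆⟦⟧^[1] ψ) (⊆-trans (▷-anti (flip I) p) (⟦⟧^[1]⊆⦅⦆ φ))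

    □-⊤-true : True V (⊤ ⊢ □ ⊤)
    □-⊤-true = ⊆-▷ I I□ stable-R□^[1] λ _ → maximum _

    □-∧-true : ∀ φ ψ → True V (□ φ ∧ □ ψ ⊢ □ (φ ∧ ψ))
    □-∧-true φ ψ = ⊆-▷ I I□ stable-R□^[1] λ z → ∧-greatest
      (≤-trans (▷-anti I (galois I□ (λ _ → x∧y≤x _ _)) z) (⦅⦆^[0]⊆⟦⟧ φ z))
      (≤-trans (▷-anti I (galois I□ (λ _ → x∧y≤y _ _)) z) (⦅⦆^[0]⊆⟦⟧ ψ z))

    ◇-⊥-true : True V (◇ ⊥ ⊢ ⊥)
    ◇-⊥-true = ▷-anti I (⊆-▷ (flip I) (flip I◇) stable-R◇^[1] λ _ → maximum _)

    ◇-∨-true : ∀ φ ψ → True V (◇ (φ ∨ ψ) ⊢ ◇ φ ∨ ◇ ψ)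
    ◇-∨-true φ ψ = ▷-anti I (⊆-▷ (flip I) (flip I◇) stable-R◇^[1] λ x → ∧-greatest
      (≤-trans (▷-anti (flip I) (galois (flip I◇) (λ _ → x∧y≤x _ _)) x) (⟦⟧^[1]⊆⦅⦆ φ x))
      (≤-trans (▷-anti (flip I) (galois (flip I◇) (λ _ → x∧y≤y _ _)) x) (⟦⟧^[1]⊆⦅⦆ ψ x)))

    module _ {Ax : Pred (Sequent Atom) 0ℓ} (ax : ∀ s → s ∈ Ax → ∀ σ → True V (s [ σ ]ₛ)) where

      soundness-[] : ∀ {s} → Logic Ax s → ∀ σ → True V (s [ σ ]ₛ)
      soundness-[] (axiom s∈Ax)         σ = ax _ s∈Ax σ
      soundness-[] id                   σ = λ _ → ≤-refl
      soundness-[] (⊥-out {p})          σ = ⊆-trans (▷-anti I (λ _ → maximum _)) (⦅⦆^[0]⊆⟦⟧ (p [ σ ]))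
      soundness-[] ⊤-in                 σ = λ _ → maximum _
      soundness-[] (∨-inˡ {p})          σ = ⊆-trans (⟦⟧⊆⦅⦆^[0] (p [ σ ])) (▷-anti I (λ _ → x∧y≤x _ _))
      soundness-[] (∨-inʳ {q = q})      σ = ⊆-trans (⟦⟧⊆⦅⦆^[0] (q [ σ ])) (▷-anti I (λ _ → x∧y≤y _ _))
      soundness-[] ∧-outˡ               σ = λ _ → x∧y≤x _ _
      soundness-[] ∧-outʳ               σ = λ _ → x∧y≤y _ _
      soundness-[] □-⊤                  σ = □-⊤-true
      soundness-[] (□-∧ {p} {q})        σ = □-∧-true (p [ σ ]) (q [ σ ])
      soundness-[] ◇-⊥                  σ = ◇-⊥-true
      soundness-[] (◇-∨ {p} {q})        σ = ◇-∨-true (p [ σ ]) (q [ σ ])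
      soundness-[] (cut d e)            σ = ⊆-trans (soundness-[] d σ) (soundness-[] e σ)
      soundness-[] (subst {s} τ d)      σ = ≡-subst (True V) (sym ([]ₛ-∘ τ σ s)) (soundness-[] d _)
      soundness-[] (∧-in d e)           σ = λ z → ∧-greatest (soundness-[] d σ z) (soundness-[] e σ z)
      soundness-[] (∨-out {φ} {ψ} {χ} d e) σ = ⊆-trans
        (▷-anti I (λ x → ∧-greatest (⟦⟧⇒⦅⦆ (φ [ σ ]) (χ [ σ ]) (soundness-[] d σ) x)
                                    (⟦⟧⇒⦅⦆ (ψ [ σ ]) (χ [ σ ]) (soundness-[] e σ) x)))
        (⦅⦆^[0]⊆⟦⟧ (χ [ σ ]))
      soundness-[] (□-mono {φ} {ψ} d)   σ = ▷-anti I□ (⟦⟧⇒⦅⦆ (φ [ σ ]) (ψ [ σ ]) (soundness-[] d σ))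
      soundness-[] (◇-mono d)           σ = ▷-anti I (▷-anti (flip I◇) (soundness-[] d σ))

      soundness : ∀ {φ ψ} → Logic Ax (φ ⊢ ψ) → True V (φ ⊢ ψ)
      soundness {φ} {ψ} d =
        ≡-subst (True V) (cong₂ _⊢_ ([]-var φ) ([]-var ψ)) (soundness-[] d var)

-- The canonical frame and completeness

module Canonical {ℓ : Level} (𝐀 : TruthValues ℓ) (reflexive : Bool)
                 {Atom : Set}
                 (derivable? : (φ ψ : Fm Atom) → Dec (CutFree._⟶_ reflexive φ ψ)) where

  open TruthValues 𝐀 using (_≤_; _⇒_; 𝟏; 𝟎; ⋀-lower; ⋀-greatest; 𝟏-⇒; 𝟎≢𝟏)
    renaming (Carrier to A; _∧_ to _⊓_)
  open Pointwise 𝐀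
  open Polarity 𝐀
  open CutFree reflexive {Atom}

  infix 3 _⊢?_

  _⊢?_ : ∀ φ ψ → Dec (φ ⟶ ψ)
  _⊢?_ = derivable?

  record Point : Set ℓ where
    constructor _⊬_by_
    field
      lhs rhs : Fm Atom
      lhs⊬rhs : ¬ (lhs ⟶ rhs)

  open Point

  -- For derivability of `a ⊢ b` this is `𝟏` exactly when the filter of `a` misses the ideal of `b`.
  refute : {P : Set} → Dec P → A
  refute P? = if does P? then 𝟎 else 𝟏

  -- The value of `refute P? ⇒ α`.
  grade : {P : Set} → Dec P → A → A
  grade P? α = if does P? then 𝟏 else α

  refute-anti : {P Q : Set} (P? : Dec P) (Q? : Dec Q) → (Q → P) → refute P? ≤ refute Q?
  refute-anti (yes _) _       f = minimum _
  refute-anti (no _)  (no _)  f = ≤-refl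
  refute-anti (no ¬p) (yes q) f = ⊥-elim (¬p (f q))

  refute-no : {P : Set} (P? : Dec P) → ¬ P → refute P? ≡ 𝟏
  refute-no (yes p) ¬p = ⊥-elim (¬p p)
  refute-no (no _)  ¬p = refl

  grade-yes : {P : Set} (P? : Dec P) → P → ∀ α → 𝟏 ≤ grade P? α
  grade-yes (yes _) p α = ≤-refl
  grade-yes (no ¬p) p α = ⊥-elim (¬p p)

  grade-no : {P : Set} (P? : Dec P) → ¬ P → ∀ α → grade P? α ≤ α
  grade-no (yes p) ¬p α = ⊥-elim (¬p p)
  grade-no (no _)  ¬p α = ≤-refl

  α≤grade : {P : Set} (P? : Dec P) → ∀ α → α ≤ grade P? α
  α≤grade (yes _) α = maximum _
  α≤grade (no _)  α = ≤-refl

  ⊓-grade : {P Q R : Set} (P? : Dec P) (Q? : Dec Q) (R? : Dec R) →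
            (R → P × Q) → (P → Q → R) → ∀ α → grade P? α ⊓ grade Q? α ≡ grade R? α
  ⊓-grade P? Q? (yes r) f g α = antisym (maximum _)
    (∧-greatest (grade-yes P? (proj₁ (f r)) α) (grade-yes Q? (proj₂ (f r)) α))
  ⊓-grade P? Q? (no ¬r) f g α = antisym (lower P? Q?)
    (∧-greatest (α≤grade P? α) (α≤grade Q? α))
    where
    lower : ∀ P? Q? → grade P? α ⊓ grade Q? α ≤ α
    lower (no _)  Q?      = x∧y≤x _ _
    lower (yes p) (no _)  = x∧y≤y _ _
    lower (yes p) (yes q) = ⊥-elim (¬r (g p q))

  module Incidence {P : Fm Atom → Fm Atom → Set} (P? : ∀ φ ψ → Dec (P φ ψ)) where

    relation : Point → Point → A
    relation z z′ = refute (P? (lhs z) (rhs z′))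

    I : Point → A × Point → A
    I z (α , z′) = relation z z′ ⇒ α

    𝟏≤I : ∀ z α z′ → P (lhs z) (rhs z′) → 𝟏 ≤ I z (α , z′)
    𝟏≤I z α z′ p with P? (lhs z) (rhs z′)
    ... | yes _ = x≤𝟎⇒k
    ... | no ¬p = ⊥-elim (¬p p)

    I≤α : ∀ z α z′ → ¬ P (lhs z) (rhs z′) → I z (α , z′) ≤ α
    I≤α z α z′ ¬p = ≤-reflexive (trans (cong (_⇒ α) (refute-no (P? (lhs z) (rhs z′)) ¬p)) (𝟏-⇒ α))

  open Incidence _⊢?_ using (I) renaming (relation to E)
  open Incidence (λ φ ψ → φ ⊢? □ ψ) using () renaming (relation to R□; I to I□; I≤α to I□≤α)
  open Incidence (λ φ ψ → ◇ φ ⊢? ψ) using () renaming (relation to R◇ᵒ; I to I◇)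

  Ext : Fm Atom → Point → A
  Ext φ z = grade (lhs z ⊢? φ) 𝟎

  -- Off the ideal the value is `α` rather than `𝟎`, because every polar `f ^[1]` is at least `α` at
  -- `(α , z)`.
  Int : Fm Atom → A × Point → A
  Int φ (α , z) = grade (φ ⊢? rhs z) α

  module _ {P : Fm Atom → Fm Atom → Set} (P? : ∀ φ ψ → Dec (P φ ψ)) where

    open Incidence P? using (𝟏≤I; I≤α) renaming (I to K)

    ▷-Int : (∀ {a φ ψ} → φ ⟶ ψ → P a φ → P a ψ) → (∀ {a φ} → ⊤ ⟶ φ → P a φ) →
            ∀ φ z → (K ▷ Int φ) z ≡ grade (P? (lhs z) φ) 𝟎
    ▷-Int mono top φ z@(a ⊬ b by _) = antisym upper (⋀-greatest _ _ lower)
      where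
      upper : (K ▷ Int φ) z ≤ grade (P? a φ) 𝟎
      upper with P? a φ
      ... | yes _ = maximum _
      ... | no ¬p = ≤-trans (⋀-lower _ (𝟎 , z′)) (≤-trans
        (⇒-monoˡ (grade-yes (φ ⊢? φ) (⟶-refl φ) 𝟎))
        (≤-trans (≤-reflexive (𝟏-⇒ _)) (I≤α z 𝟎 z′ ¬p)))
        where
        z′ : Point
        -- The least filter against the ideal of `φ`: `Int φ` is `𝟏` there, and the grade `𝟎`
        -- exposes the failure of `P`.
        z′ = ⊤ ⊬ φ by λ d → ¬p (top d)
      lower : ∀ x → grade (P? a φ) 𝟎 ≤ Int φ x ⇒ K z x
      lower (α , z′) with P? a φ
      ... | no _  = minimum _
      ... | yes p with φ ⊢? rhs z′
      ...   | yes d = 𝟏≤k⇒x≤y⇒k (𝟏≤I z α z′ (mono d p))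
      ...   | no _  = ⇒-swap (≤-trans k≤y⇒k k≤y⇒k)

    ▷-Ext : (∀ {φ ψ b} → φ ⟶ ψ → P ψ b → P φ b) → (∀ {φ b} → φ ⟶ ⊥ → P φ b) →
            ∀ φ α z → (flip K ▷ Ext φ) (α , z) ≡ grade (P? φ (rhs z)) α
    ▷-Ext mono bot φ α z@(a ⊬ b by _) = antisym upper (⋀-greatest _ _ lower)
      where
      upper : (flip K ▷ Ext φ) (α , z) ≤ grade (P? φ b) α
      upper with P? φ b
      ... | yes _ = maximum _
      ... | no ¬p = ≤-trans (⋀-lower _ z′) (≤-trans
        (⇒-monoˡ (grade-yes (φ ⊢? φ) (⟶-refl φ) 𝟎))
        (≤-trans (≤-reflexive (𝟏-⇒ _)) (I≤α z′ α z ¬p)))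
        where
        z′ : Point
        z′ = φ ⊬ ⊥ by λ d → ¬p (bot d)
      lower : ∀ z′ → grade (P? φ b) α ≤ Ext φ z′ ⇒ K z′ (α , z)
      lower z′ with lhs z′ ⊢? φ
      ... | no _  = x≤𝟎⇒k
      ... | yes d with P? φ b
      ...   | yes p = 𝟏≤k⇒x≤y⇒k (𝟏≤I z′ α z (mono d p))
      ...   | no _  = ≤-trans k≤y⇒k k≤y⇒k

    -- If `P a b` amounts to `a ⊢ c` with `c` depending on `b` alone, each column of `K` is a column
    -- of `I`, provided `c` occurs on the right of a point.
    stable-column : (∀ b → ∃ λ c → ∀ a → (P a b → a ⟶ c) × (a ⟶ c → P a b)) →
                    ∀ β x → Stable I K ⁅ β / x ⁆
    stable-column represent = stable-⁅⁆ I K collapse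
      where
      collapse : ∀ w x → 𝟏 ≤ K w x ⊎ ∃ λ x′ → I w x′ ≤ K w x × (∀ w′ → K w′ x ≤ I w′ x′)
      collapse w (α , z) with represent (rhs z) | P? (lhs w) (rhs z)
      ... | c , P⇔ | yes p = inj₁ x≤𝟎⇒k
      ... | c , P⇔ | no ¬p = inj₂
        -- A column of `I` depends on the right formula alone; `lhs w` is chosen to make the sequent
        -- underivable.
        ( (α , (lhs w ⊬ c by λ d → ¬p (proj₂ (P⇔ (lhs w)) d)))
        , ⇒-monoˡ (≤-reflexive (sym (refute-no (lhs w ⊢? c) λ d → ¬p (proj₂ (P⇔ (lhs w)) d))))
        , λ w′ → ⇒-monoˡ (refute-anti (lhs w′ ⊢? c) (P? (lhs w′) (rhs z)) (proj₁ (P⇔ (lhs w′)))))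

    stable-row : (∀ a → ∃ λ c → ∀ b → (P a b → c ⟶ b) × (c ⟶ b → P a b)) →
                 ∀ β z → Stable (flip I) (flip K) ⁅ β / z ⁆
    stable-row represent = stable-⁅⁆ (flip I) (flip K) collapse
      where
      collapse : ∀ x z → 𝟏 ≤ K z x ⊎ ∃ λ z′ → I z′ x ≤ K z x × (∀ x′ → K z x′ ≤ I z′ x′)
      collapse (α , w) z with represent (lhs z) | P? (lhs z) (rhs w)
      ... | c , P⇔ | yes p = inj₁ x≤𝟎⇒k
      ... | c , P⇔ | no ¬p = inj₂
        ( (c ⊬ rhs w by λ d → ¬p (proj₂ (P⇔ (rhs w)) d))
        , ⇒-monoˡ (≤-reflexive (sym (refute-no (c ⊢? rhs w) λ d → ¬p (proj₂ (P⇔ (rhs w)) d))))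
        , λ (_ , w′) → ⇒-monoˡ (refute-anti (c ⊢? rhs w′) (P? (lhs z) (rhs w′)) (proj₁ (P⇔ (rhs w′)))))

  graph : Graph 𝐀
  graph = record
    { Z        = Point
    ; nonempty = ⊤ ⊬ ⊥ by λ d → null-resp d tt
    ; E        = E
    ; R◇       = λ z z′ → R◇ᵒ z′ z
    ; R□       = R□
    ; E-refl   = λ z → refute-no (lhs z ⊢? rhs z) (lhs⊬rhs z)
    }

  -- Columns of `R□` and rows of `R◇` are represented by `□` and `◇` themselves, the other two by
  -- the adjoints.
  frame : Frame 𝐀
  frame = record
    { graph         = graph
    ; R□^[0]-stable = λ z α β → stable-column (λ φ ψ → φ ⊢? □ ψ)
        (λ b → □ b , λ a → (λ d → d) , (λ d → d)) β (α , z)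
    ; R□^[1]-stable = λ z β → stable-row (λ φ ψ → φ ⊢? □ ψ)
        (λ a → unbox a , λ b → unbox-mono , □R) β z
    ; R◇^[1]-stable = λ z α β → stable-column (λ φ ψ → ◇ φ ⊢? ψ)
        (λ b → undia b , λ a → undia-mono , ◇L) β (α , z)
    ; R◇^[0]-stable = λ z β → stable-row (λ φ ψ → ◇ φ ⊢? ψ)
        (λ a → ◇ a , λ b → (λ d → d) , (λ d → d)) β z
    }

  open Frame frame using (_^[0]; _^[1]; R□^[0]; R◇^[0])

  Ext^[1] : ∀ φ → Ext φ ^[1] ≗ Int φ
  Ext^[1] φ (α , z) = ▷-Ext _⊢?_ ⟶-trans (λ d → ⟶-trans d (null tt)) φ α z

  Int^[0] : ∀ φ → Int φ ^[0] ≗ Ext φ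
  Int^[0] = ▷-Int _⊢?_ (λ d e → ⟶-trans e d) (λ d → ⟶-trans (full tt) d)

  R□^[0]-Int : ∀ φ → R□^[0] (Int φ) ≗ Ext (□ φ)
  R□^[0]-Int = ▷-Int (λ φ ψ → φ ⊢? □ ψ)
    (λ d e → ⟶-trans e (□R d)) (λ d → full (full-resp d tt))

  R◇^[0]-Ext : ∀ φ → R◇^[0] (Ext φ) ≗ Int (◇ φ)
  R◇^[0]-Ext φ (α , z) = ▷-Ext (λ φ ψ → ◇ φ ⊢? ψ)
    (λ d e → ⟶-trans (◇L d) e) (λ d → null (null-resp d tt)) φ α z

  valuation : Valuation Atom frame
  valuation = record
    { ext     = λ p → Ext (var p)
    ; int     = λ p → Int (var p)
    ; ext^[1] = λ p → Ext^[1] (var p)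
    ; int^[0] = λ p → Int^[0] (var p)
    }

  ▷-cong : {W X : Set ℓ} (K : W → X → A) {u v : X → A} → u ≗ v → K ▷ u ≗ K ▷ v
  ▷-cong K p w = antisym (▷-anti K (λ x → ≤-reflexive (sym (p x))) w)
                         (▷-anti K (λ x → ≤-reflexive (p x)) w)

  _≗-trans_ : {W : Set ℓ} {f g h : W → A} → f ≗ g → g ≗ h → f ≗ h
  (p ≗-trans q) w = trans (p w) (q w)

  Ext-∧ : ∀ φ ψ z → Ext φ z ⊓ Ext ψ z ≡ Ext (φ ∧ ψ) z
  Ext-∧ φ ψ z = ⊓-grade (lhs z ⊢? φ) (lhs z ⊢? ψ) (lhs z ⊢? φ ∧ ψ)
    (λ d → ∧R⁻₁ d , ∧R⁻₂ d) ∧R 𝟎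

  Int-∨ : ∀ φ ψ x → Int φ x ⊓ Int ψ x ≡ Int (φ ∨ ψ) x
  Int-∨ φ ψ (α , z) = ⊓-grade (φ ⊢? rhs z) (ψ ⊢? rhs z) (φ ∨ ψ ⊢? rhs z)
    (λ d → ⟶-trans (∨R₁ (⟶-refl φ)) d , ⟶-trans (∨R₂ (⟶-refl ψ)) d) ∨L α

  from-Ext : ∀ φ {f} → f ≗ Ext φ → f ≗ Ext φ × f ^[1] ≗ Int φ
  from-Ext φ p = p , ▷-cong (flip I) p ≗-trans Ext^[1] φ

  from-Int : ∀ φ {u} → u ≗ Int φ → u ^[0] ≗ Ext φ × u ≗ Int φ
  from-Int φ p = ▷-cong I p ≗-trans Int^[0] φ , p

  truth : ∀ φ → ⟦ valuation ⟧ φ ≗ Ext φ × ⦅ valuation ⦆ φ ≗ Int φ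
  truth ⊥       = from-Int ⊥ λ (α , z) → antisym (grade-yes (⊥ ⊢? rhs z) (null tt) α) (maximum _)
  truth ⊤       = from-Ext ⊤ λ z → antisym (grade-yes (lhs z ⊢? ⊤) (full tt) 𝟎) (maximum _)
  truth (var p) = (λ _ → refl) , (λ _ → refl)
  truth (φ ∧ ψ) = from-Ext (φ ∧ ψ) λ z →
    trans (cong₂ _⊓_ (proj₁ (truth φ) z) (proj₁ (truth ψ) z)) (Ext-∧ φ ψ z)
  truth (φ ∨ ψ) = from-Int (φ ∨ ψ) λ x →
    trans (cong₂ _⊓_ (proj₂ (truth φ) x) (proj₂ (truth ψ) x)) (Int-∨ φ ψ x)
  truth (□ φ)   = from-Ext (□ φ) (▷-cong I□ (proj₂ (truth φ)) ≗-trans R□^[0]-Int φ)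
  truth (◇ φ)   = from-Int (◇ φ) (▷-cong (flip I◇) (proj₁ (truth φ)) ≗-trans R◇^[0]-Ext φ)

  completeness : ∀ φ ψ → True valuation (φ ⊢ ψ) → φ ⟶ ψ
  completeness φ ψ t with φ ⊢? ψ
  ... | yes d = d
  ... | no ¬d = ⊥-elim (𝟎≢𝟏 (antisym (minimum _) 𝟏≤𝟎))
    where
    z : Point
    z = φ ⊬ ψ by ¬d
    𝟏≤𝟎 : 𝟏 ≤ 𝟎
    𝟏≤𝟎 = ≤-trans (grade-yes (φ ⊢? φ) (⟶-refl φ) 𝟎)
      (≤-trans (≤-reflexive (sym (proj₁ (truth φ) z)))
        (≤-trans (t z)
          (≤-trans (≤-reflexive (proj₁ (truth ψ) z)) (grade-no (φ ⊢? ψ) ¬d 𝟎))))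

  -- A point whose left formula proved `□ ⊥` would have a null left formula, hence be derivable. So
  -- every point is `R□`-related to `⊤ ⊬ ⊥` with value `𝟏`.
  frame∈𝒦₀ : frame ∈ 𝒦₀ Atom
  frame∈𝒦₀ V z = ≤-trans (⋀-lower _ (𝟎 , z′))
    (≤-trans (≤-reflexive (𝟏-⇒ _)) (≤-trans (I□≤α z 𝟎 z′ ¬□⊥) (minimum _)))
    where
    z′ : Point
    z′ = ⊤ ⊬ ⊥ by λ d → null-resp d tt
    ¬□⊥ : ¬ (lhs z ⟶ □ ⊥)
    ¬□⊥ d = lhs⊬rhs z (null (null-resp d tt))

  -- Since `a ⊢ □ b` entails `a ⊢ b`, `E` lies below `R□`, so the box lies below the closure given
  -- by `E`.
  frame∈𝒦₁ : T reflexive → (p : Atom) → frame ∈ 𝒦₁ p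
  frame∈𝒦₁ r p V z = ≤-trans
    (⋀-greatest _ _ λ x@(α , z′) → ≤-trans (⋀-lower _ x)
      (⇒-monoʳ (⇒-monoˡ (refute-anti (lhs z ⊢? rhs z′) (lhs z ⊢? □ rhs z′)
        λ d → ⟶-trans d (□L r (⟶-refl _))))))
    (≤-reflexive (Valuation.int^[0] V p z))

-- Soundness and completeness of `L₀` and `L₁`

theoremB9 : {ℓ : Level} (𝐀 : TruthValues ℓ) (Atom : Set) → Atom ↣ ℕ →
    ((φ ψ : Fm Atom) →
    (φ ⊢ ψ) ∈ L₀ ⇔ ((𝔾 : Frame 𝐀) → 𝔾 ∈ 𝒦₀ Atom → 𝔾 ⊩ (φ ⊢ ψ)))
    × ((p : Atom) (φ ψ : Fm Atom) →
    (φ ⊢ ψ) ∈ L₁ p ⇔ ((𝔾 : Frame 𝐀) → 𝔾 ∈ 𝒦₁ p → 𝔾 ⊩ (φ ⊢ ψ)))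
theoremB9 𝐀 Atom inj =
    (λ φ ψ → mk⇔
      -- `□ ⊥ ⊢ ⊥` contains no atoms, so every substitution fixes it.
      (λ d 𝔾 𝔾∈𝒦₀ V → Soundness.soundness 𝔾 V (λ { _ refl σ → 𝔾∈𝒦₀ V }) d)
      (λ valid → CutFree.cutFree⇒logic false (axiom refl) (λ ())
        (C₀.completeness φ ψ (valid C₀.frame C₀.frame∈𝒦₀ C₀.valuation))))
  , (λ p φ ψ → mk⇔
      (λ d 𝔾 𝔾∈𝒦₁ V → Soundness.soundness 𝔾 V
        (λ { _ refl σ → 𝔾∈𝒦₁ (Soundness.formula-valuation 𝔾 V (σ p)) }) d)
      (λ valid → CutFree.cutFree⇒logic true
        -- Substituting `⊥` for `p` in `□ p ⊢ p` gives `□ ⊥ ⊢ ⊥`.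
        (subst (λ _ → ⊥) (axiom refl)) (λ _ a → subst (λ _ → a) (axiom refl))
        (C₁.completeness φ ψ (valid C₁.frame (C₁.frame∈𝒦₁ tt p) C₁.valuation))))
  where
  -- The injection into `ℕ` gives decidable equality of atoms, on which proof search depends.
  module C₀ = Canonical 𝐀 false (CutFree._⟶?_ false (via-injection inj _≟ⁿ_))
  module C₁ = Canonical 𝐀 true (CutFree._⟶?_ true (via-injection inj _≟ⁿ_))
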